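{- Let $p$ and $q$ be positive integers with $p<q$ (not necessarily coprime). Then $m_{p/q}<m_{p/(q+1)}$ and $m_{p/q}<m_{(p+1)/q}$, where $m_{r/s}$ is the number of perfect matchings of the lattice path snake graph $\mathcal G_{r/s}$ described in the context.
   Context: For positive integers $r\le s$, let $\ell_{r/s}$ be the line segment from $(0,0)$ to $(s,r)$, and let $L_{r/s}$ be the unique lattice path in $\mathbb Z\times\mathbb Z$ from $(0,0)$ to $(s,r)$ using unit east and north steps, lying on or below $\ell_{r/s}$, such that no lattice points lie strictly between $L_{r/s}$ and $\ell_{r/s}$ (when $\gcd(r,s)=1$ this is the Christoffel path, lying strictly below $\ell_{r/s}$ except at its endpoints). The lattice path snake graph $\mathcal G_{r/s}$ is the planar graph formed by squares (tiles) of side length $1/2$ lying on the path $L_{r/s}$ (i.e. the tiles with vertices in $\tfrac12\mathbb Z^2$ lying weakly above/left of $L_{r/s}$ inside the rectangle $[0,s]\times[0,r]$ and touching $L_{r/s}$), starting with the tile whose south-west vertex is $(0.5,0)$ and ending with the tile whose north-east vertex is $(s,r-0.5)$; consecutive tiles are glued along an edge, each tile lying to the right of or above the previous one. The vertices and edges of $\mathcal G_{r/s}$ are those of its tiles. A perfect matching is a set of edges such that every vertex lies on exactly one of them. Define $m_{r/s}$ to be the number of perfect matchings of $\mathcal G_{r/s}$. When $\gcd(r,s)=1$ and $r<s$, $m_{r/s}$ coincides with the Markov number indexed by $r/s$ via the Farey tree (e.g. $m_{3/5}=433$). -}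

module Defs where

open import Data.Nat using (ℕ; zero; suc; _+_; _*_; _∸_; _⊓_; _≡ᵇ_; NonZero)
open import Data.Nat.DivMod using (_/_)
open import Data.Nat.Properties using (_≟_)
open import Data.Bool using (Bool; true; false; _∧_; _∨_; if_then_else_)
open import Data.Product using (_×_; _,_; proj₁; proj₂)
open import Data.Product.Properties using (≡-dec)
open import Data.List using (List; []; _∷_; _++_; map; concatMap; filter; filterᵇ; length; deduplicate; upTo; allFin)
open import Data.List.Relation.Unary.All using (All; all?)
open import Data.Sum using (_⊎_)
open import Relation.Nullary.Decidable using (_⊎-dec_)
open import Relation.Binary.PropositionalEquality using (_≡_)
open import Relation.Binary.Definitions using (DecidableEquality)
open import Relation.Nullary using (Dec; yes; no)
open import Relation.Unary using (Decidable)

-- All coordinates are DOUBLED: the point (X , Y) : ℕ × ℕ stands for (X/2 , Y/2) ∈ ½ℤ².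
-- A tile (i , j) is the square [i/2,(i+1)/2] × [j/2,(j+1)/2] of side 1/2.

Point : Set
Point = ℕ × ℕ

_≟P_ : DecidableEquality Point
_≟P_ = ≡-dec _≟_ _≟_

-- Height of the lattice path L_{r/s} above the integer abscissa x:
-- L_{r/s} is the highest east/north lattice path on or below ℓ_{r/s};
-- at abscissa x it climbs (north) from height ⌊r(x-1)/s⌋ to ⌊r x / s⌋,
-- then goes east at height ⌊r x / s⌋ to abscissa x+1.
pathHeight : (r s : ℕ) → .{{NonZero s}} → ℕ → ℕ
pathHeight r s x = (r * x) / s

-- The tiles of side 1/2 inside [0,s]×[0,r], weakly above/left of L_{r/s} and touching L_{r/s}
-- (closures meeting L), listed in order along the path. For the unit column [k,k+1]:
--  * the left half-column (i = 2k) contributes only the tile sitting on the east step at height h(k);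
--  * the right half-column (i = 2k+1) contributes the tiles from height h(k) up to height h(k+1)
--    (touching the north step at abscissa k+1), cut at the top of the rectangle.
-- All tiles touching L, in order along the path:
allPathTiles : (r s : ℕ) → .{{NonZero s}} → List Point
allPathTiles r s = concatMap column (upTo s)
  where
    h = pathHeight r s
    range : ℕ → ℕ → List ℕ
    range a b = map (a +_) (upTo (suc (b ∸ a)))
    column : ℕ → List Point
    column k = ((2 * k) , (2 * h k))
             ∷ map (λ j → (suc (2 * k) , j)) (range (2 * h k) ((2 * h (suc k)) ⊓ (2 * r ∸ 1)))

-- The snake graph G_{r/s}: starts with the tile whose SW vertex is (0.5,0), i.e. doubled (1,0),
-- and ends with the tile whose NE vertex is (s, r-0.5), i.e. the tile with SW corner
-- doubled (2s-1, 2r-1). The first path tile (SW vertex (0,0)) and the last one are dropped.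
snakeTiles : (r s : ℕ) → .{{NonZero s}} → List Point
snakeTiles r s = filterᵇ keep (allPathTiles r s)
  where
    isP : Point → Point → Bool
    isP (a , b) (c , d) = (a ≡ᵇ c) ∧ (b ≡ᵇ d)
    keep : Point → Bool
    keep t = if isP t (0 , 0) ∨ isP t (2 * s ∸ 1 , 2 * r ∸ 1) then false else true

-- An edge of length 1/2: its lower/left endpoint together with a direction.
data Dir : Set where
  H V : Dir

_≟D_ : DecidableEquality Dir
H ≟D H = yes _≡_.refl
H ≟D V = no (λ ())
V ≟D H = no (λ ())
V ≟D V = yes _≡_.refl

Edge : Set
Edge = Point × Dir

_≟E_ : DecidableEquality Edge
_≟E_ = ≡-dec _≟P_ _≟D_

endpoints : Edge → Point × Point
endpoints ((a , b) , H) = (a , b) , (suc a , b)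
endpoints ((a , b) , V) = (a , b) , (a , suc b)

tileEdges : Point → List Edge
tileEdges (i , j) = ((i , j) , H) ∷ ((i , suc j) , H) ∷ ((i , j) , V) ∷ ((suc i , j) , V) ∷ []

tileVertices : Point → List Point
tileVertices (i , j) = (i , j) ∷ (suc i , j) ∷ (i , suc j) ∷ (suc i , suc j) ∷ []

snakeEdges : (r s : ℕ) → .{{NonZero s}} → List Edge
snakeEdges r s = deduplicate _≟E_ (concatMap tileEdges (snakeTiles r s))

snakeVertices : (r s : ℕ) → .{{NonZero s}} → List Point
snakeVertices r s = deduplicate _≟P_ (concatMap tileVertices (snakeTiles r s))

-- All sub-lists (= subsets, since the edge list has no repetitions).
sublists : {A : Set} → List A → List (List A)
sublists [] = [] ∷ []
sublists (x ∷ xs) = let ys = sublists xs in ys ++ map (x ∷_) ys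

_∈ₑ_ : Point → Edge → Set
v ∈ₑ e = (v ≡ proj₁ (endpoints e)) ⊎ (v ≡ proj₂ (endpoints e))

_∈ₑ?_ : (v : Point) → (e : Edge) → Dec (v ∈ₑ e)
v ∈ₑ? e = (v ≟P proj₁ (endpoints e)) ⊎-dec (v ≟P proj₂ (endpoints e))

IsPerfectMatching : List Point → List Edge → Set
IsPerfectMatching vs M = All (λ v → length (filter (v ∈ₑ?_) M) ≡ 1) vs

isPerfectMatching? : (vs : List Point) → Decidable (IsPerfectMatching vs)
isPerfectMatching? vs M = all? (λ v → length (filter (v ∈ₑ?_) M) ≟ 1) vs

-- m_{r/s}: the number of perfect matchings of G_{r/s}, i.e. the number of subsets of the
-- edge set of G_{r/s} which are perfect matchings.
-- (For s = 0 the snake graph is undefined; we set the junk value 0. The theorem only uses s ≥ 1.)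
m : ℕ → ℕ → ℕ
m r zero = 0
m r (suc s) = length (filter (isPerfectMatching? (snakeVertices r (suc s))) (sublists (snakeEdges r (suc s))))

private
  _ : snakeTiles 3 5 ≡ (1 , 0) ∷ (2 , 0) ∷ (3 , 0) ∷ (3 , 1) ∷ (3 , 2) ∷ (4 , 2) ∷ (5 , 2) ∷ (6 , 2) ∷ (7 , 2) ∷ (7 , 3) ∷ (7 , 4) ∷ (8 , 4) ∷ (9 , 4) ∷ []
  _ = _≡_.refl
  _ : m 1 1 ≡ 2
  _ = _≡_.refl

{-# OPTIONS --safe #-}
module Submission where

-- Gluing tiles one at a time, the pair (matchings using the left edge of the first tile,
-- matchings using its bottom edge) evolves by a 2×2 matrix, and m_{r/s} is the sum of the
-- entries of a product of the symmetric matrices A (for HH) and B (for VV) along the path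
-- L_{r/s} stripped of its first and last steps.  As A B and B A differ by a multiple of a
-- rotation, replacing u V H v by u H V v does not increase the weight when the reverse of u
-- is lexicographically below v, where H > end of word > V.  With f (x , y) = r x − s y, this
-- holds at the first minimum of f along a path from (1 , 0) to (s , r − 1) if that minimum
-- is negative.
-- Performing such exchanges, every path with f < r + s is pushed, without increase of the
-- weight, to the path with 0 ≤ f < r + s, which is L_{r/s}.  Both L_{p/(q+1)} without its
-- first inner H and L_{(p+1)/q} without its last inner V are such paths for p/q, and the
-- deletion of a letter strictly decreases the weight.

open import Defs
open import Data.Nat using (ℕ; _<_; suc)
open import Data.Product using (_×_)
open import Data.Bool using (Bool; true; false; T; _∧_; _∨_; if_then_else_)
open import Data.Bool.Properties using (T?; ∧-zeroʳ)
open import Data.Empty using (⊥-elim)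
open import Data.List using (List; []; _∷_; _++_; _ʳ++_; map; filter; filterᵇ; length; concat; concatMap; deduplicate; upTo; applyUpTo)
open import Data.List.Properties using (++-ʳ++; filter-++; filter-accept; filter-none; filter-reject; length-++)
open import Data.List.Membership.Propositional using (_∈_)
open import Data.List.Membership.Propositional.Properties using (∈-++⁺ˡ; ∈-++⁻; ∈-deduplicate⁺; ∈-deduplicate⁻)
import Data.List.Membership.Setoid.Properties as SetoidMembership
open import Data.List.Relation.Binary.BagAndSetEquality using (∼bag⇒↭)
open import Data.List.Relation.Binary.Permutation.Propositional as ↭ using (_↭_; prep; swap; ↭-refl)
open import Data.List.Relation.Binary.Permutation.Propositional.Properties using (filter-↭; ↭-length; ++⁺ˡ)
open import Data.List.Relation.Binary.Subset.Propositional using (_⊆_)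
open import Data.List.Relation.Unary.All as All using (All; []; _∷_)
open import Data.List.Relation.Unary.AllPairs using ([]; _∷_)
open import Data.List.Relation.Unary.Any using (here; there)
open import Data.List.Relation.Unary.Unique.Propositional using (Unique)
import Data.List.Relation.Unary.Unique.DecPropositional.Properties as UniqueDec
open import Data.Nat using (zero; _+_; _*_; _∸_; _≤_; _⊓_; _≡ᵇ_; s≤s; z<s; NonZero; >-nonZero)
open import Data.Nat.DivMod using (_/_; +-distrib-/-∣ʳ; m<n⇒m/n≡0; m*n/n≡m)
open import Data.Nat.Divisibility using (n∣m*n)
open import Data.Nat.Induction using (<-wellFounded)
open import Data.Nat.ListAction using (sum)
open import Data.Nat.Properties
open import Data.Nat.Tactic.RingSolver using (solve-∀)
open import Data.Product using (_,_; proj₁; proj₂; ∃-syntax)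
open import Data.Sum using (inj₁; inj₂)
open import Data.Unit using (tt)
open import Function using (_∘_; case_of_)
open import Function.Bundles using (mk↔ₛ′)
open import Induction.WellFounded using (Acc; acc)
open import Level using (0ℓ)
open import Relation.Binary.PropositionalEquality using (_≡_; _≢_; refl; sym; trans; cong; cong₂; subst; subst₂; setoid; module ≡-Reasoning)
open import Relation.Nullary using (yes; no; ¬_; does)
open import Relation.Nullary.Decidable using (dec-true; dec-false)
open import Relation.Unary using (Pred; Decidable)

-- Words of lattice paths

Word : Set
Word = List Dir

#H #V : Word → ℕ
#H [] = 0
#H (H ∷ w) = suc (#H w)
#H (V ∷ w) = #H w
#V [] = 0
#V (H ∷ w) = #V w
#V (V ∷ w) = suc (#V w)

-- The weight of a word as a product of matrices

double : Dir → ℕ × ℕ → ℕ × ℕ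
double H (x , y) = x + y + x , x + y
double V (x , y) = x + y , x + y + y

val : Word → ℕ × ℕ
val [] = 1 , 1
val (z ∷ w) = double z (val w)

⟨_∣_⟩ : ℕ × ℕ → ℕ × ℕ → ℕ
⟨ (x , y) ∣ (x′ , y′) ⟩ = x * x′ + y * y′

weight : Word → ℕ
weight w = ⟨ (1 , 1) ∣ val w ⟩

double-selfAdjoint : ∀ z v v′ → ⟨ double z v ∣ v′ ⟩ ≡ ⟨ v ∣ double z v′ ⟩
double-selfAdjoint H (x , y) (x′ , y′) = lemma x y x′ y′
  where
  lemma : ∀ x y x′ y′ → (x + y + x) * x′ + (x + y) * y′ ≡ x * (x′ + y′ + x′) + y * (x′ + y′)
  lemma = solve-∀
double-selfAdjoint V (x , y) (x′ , y′) = lemma x y x′ y′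
  where
  lemma : ∀ x y x′ y′ → (x + y) * x′ + (x + y + y) * y′ ≡ x * (x′ + y′) + y * (x′ + y′ + y′)
  lemma = solve-∀

-- The matrices are symmetric, so the letters of the reversed prefix can be moved across the
-- bilinear form one at a time. An exchange in the middle of a word then involves only the vectors
-- `val u` and `val v`.
weight-ʳ++ : ∀ u v → weight (u ʳ++ v) ≡ ⟨ val u ∣ val v ⟩
weight-ʳ++ [] v = refl
weight-ʳ++ (z ∷ u) v = trans (weight-ʳ++ u (z ∷ v)) (sym (double-selfAdjoint z (val u) (val v)))

-- H > end of word > V, as the ratio of the entries of val is > 1, = 1 and < 1 respectively.
data _≼_ : Word → Word → Set where
  []≼[] : [] ≼ []
  []≼H  : ∀ {v} → [] ≼ (H ∷ v)
  V≼[]  : ∀ {u} → (V ∷ u) ≼ []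
  V≼H   : ∀ {u v} → (V ∷ u) ≼ (H ∷ v)
  cons  : ∀ z {u v} → u ≼ v → (z ∷ u) ≼ (z ∷ v)

-- Both matrices have determinant 1, so a common first letter leaves the difference of the two
-- products unchanged. Once the common letters are stripped, the number 1 weakly separates the two
-- ratios.
≼⇒slope≤ : ∀ {u v} → u ≼ v → proj₁ (val u) * proj₂ (val v) ≤ proj₂ (val u) * proj₁ (val v)
≼⇒slope≤ []≼[] = ≤-refl
≼⇒slope≤ ([]≼H {v}) = *-monoʳ-≤ 1 (m≤m+n _ (proj₁ (val v)))
≼⇒slope≤ (V≼[] {u}) = *-monoˡ-≤ 1 (m≤m+n (proj₁ (val (V ∷ u))) (proj₂ (val u)))
≼⇒slope≤ (V≼H {u} {v}) =
  *-mono-≤ (m≤m+n (proj₁ (val (V ∷ u))) (proj₂ (val u))) (m≤m+n (proj₂ (val (H ∷ v))) (proj₁ (val v)))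
≼⇒slope≤ (cons H {u} {v} u≼v) = subst₂ _≤_ (left x y x′ y′) (right x y x′ y′) (+-monoʳ-≤ _ (≼⇒slope≤ u≼v))
  where
  x = proj₁ (val u) ; y = proj₂ (val u) ; x′ = proj₁ (val v) ; y′ = proj₂ (val v)
  left : ∀ x y x′ y′ → (2 * (x * x′) + x * y′ + y * x′ + y * y′) + x * y′ ≡ (x + y + x) * (x′ + y′)
  left = solve-∀
  right : ∀ x y x′ y′ → (2 * (x * x′) + x * y′ + y * x′ + y * y′) + y * x′ ≡ (x + y) * (x′ + y′ + x′)
  right = solve-∀
≼⇒slope≤ (cons V {u} {v} u≼v) = subst₂ _≤_ (left x y x′ y′) (right x y x′ y′) (+-monoʳ-≤ _ (≼⇒slope≤ u≼v))
  where
  x = proj₁ (val u) ; y = proj₂ (val u) ; x′ = proj₁ (val v) ; y′ = proj₂ (val v)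
  left : ∀ x y x′ y′ → (x * x′ + x * y′ + y * x′ + 2 * (y * y′)) + x * y′ ≡ (x + y) * (x′ + y′ + y′)
  left = solve-∀
  right : ∀ x y x′ y′ → (x * x′ + x * y′ + y * x′ + 2 * (y * y′)) + y * x′ ≡ (x + y + y) * (x′ + y′)
  right = solve-∀

-- `common` is the part of the bilinear form shared by both orders of the letters; the remainders
-- are twice the cross products compared by `≼⇒slope≤`.
weight-swap-≤ : ∀ {u v} → u ≼ v → weight (u ʳ++ (H ∷ V ∷ v)) ≤ weight (u ʳ++ (V ∷ H ∷ v))
weight-swap-≤ {u} {v} u≼v = begin
  weight (u ʳ++ (H ∷ V ∷ v))                   ≡⟨ weight-ʳ++ u (H ∷ V ∷ v) ⟩
  ⟨ val u ∣ val (H ∷ V ∷ v) ⟩                  ≡⟨ left x y x′ y′ ⟩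
  common x y x′ y′ + 2 * (x * y′)              ≤⟨ +-monoʳ-≤ (common x y x′ y′) (*-monoʳ-≤ 2 (≼⇒slope≤ u≼v)) ⟩
  common x y x′ y′ + 2 * (y * x′)              ≡⟨ right x y x′ y′ ⟩
  ⟨ val u ∣ val (V ∷ H ∷ v) ⟩                  ≡⟨ weight-ʳ++ u (V ∷ H ∷ v) ⟨
  weight (u ʳ++ (V ∷ H ∷ v))                   ∎
  where
  open ≤-Reasoning
  x = proj₁ (val u) ; y = proj₂ (val u) ; x′ = proj₁ (val v) ; y′ = proj₂ (val v)
  common : ℕ → ℕ → ℕ → ℕ → ℕ
  common x y x′ y′ = 3 * (x * x′) + 2 * (x * y′) + 2 * (y * x′) + 3 * (y * y′)
  left : ∀ x y x′ y′ →
    x * ((x′ + y′) + (x′ + y′ + y′) + (x′ + y′)) + y * ((x′ + y′) + (x′ + y′ + y′)) ≡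
    (3 * (x * x′) + 2 * (x * y′) + 2 * (y * x′) + 3 * (y * y′)) + 2 * (x * y′)
  left = solve-∀
  right : ∀ x y x′ y′ →
    (3 * (x * x′) + 2 * (x * y′) + 2 * (y * x′) + 3 * (y * y′)) + 2 * (y * x′) ≡
    x * ((x′ + y′ + x′) + (x′ + y′)) + y * ((x′ + y′ + x′) + (x′ + y′) + (x′ + y′))
  right = solve-∀

_≪_ : ℕ × ℕ → ℕ × ℕ → Set
(x , y) ≪ (x′ , y′) = x < x′ × y < y′

double-≪ : ∀ z {v v′} → v ≪ v′ → double z v ≪ double z v′
double-≪ H (p , q) = +-mono-< (+-mono-< p q) p , +-mono-< p q
double-≪ V (p , q) = +-mono-< p q , +-mono-< (+-mono-< p q) q

val-positive : ∀ w → 0 < proj₁ (val w) × 0 < proj₂ (val w)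
val-positive [] = z<s , z<s
val-positive (H ∷ w) with val-positive w
... | p , q = <-≤-trans p (≤-trans (m≤m+n _ _) (m≤m+n _ _)) , <-≤-trans p (m≤m+n _ _)
val-positive (V ∷ w) with val-positive w
... | p , q = <-≤-trans p (m≤m+n _ _) , <-≤-trans p (≤-trans (m≤m+n _ _) (m≤m+n _ _))

≪-double : ∀ z {v} → 0 < proj₁ v × 0 < proj₂ v → v ≪ double z v
≪-double H {x , y} (p , q) = m<n+m x {x + y} (<-≤-trans p (m≤m+n x y)) , m<n+m y p
≪-double V {x , y} (p , q) = m<m+n x q , m<n+m y {x + y} (<-≤-trans p (m≤m+n x y))

weight-< : ∀ {u v} → val u ≪ val v → weight u < weight v
weight-< (p , q) = +-mono-< (*-monoʳ-< 1 p) (*-monoʳ-< 1 q)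

-- Inversions, and bounds on f along a path

inversions : Word → ℕ
inversions [] = 0
inversions (H ∷ w) = inversions w
inversions (V ∷ w) = #H w + inversions w

#H-ʳ++ : ∀ u {v v′} → #H v ≡ #H v′ → #H (u ʳ++ v) ≡ #H (u ʳ++ v′)
#H-ʳ++ [] e = e
#H-ʳ++ (H ∷ u) e = #H-ʳ++ u (cong suc e)
#H-ʳ++ (V ∷ u) e = #H-ʳ++ u e

-- Makes the descent by exchanges terminate. Each V of the prefix counts all H after it, hence the
-- condition on `#H`.
inversions-ʳ++-< : ∀ u {v v′} → #H v ≡ #H v′ → inversions v < inversions v′ →
  inversions (u ʳ++ v) < inversions (u ʳ++ v′)
inversions-ʳ++-< [] e lt = lt
inversions-ʳ++-< (H ∷ u) e lt = inversions-ʳ++-< u (cong suc e) lt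
inversions-ʳ++-< (V ∷ u) e lt = inversions-ʳ++-< u e (+-mono-≤-< (≤-reflexive e) lt)

-- Follows f = r x − s y, up to an additive constant, from the value c to the value e along w.
data NonNeg (r s : ℕ) : ℕ → Word → ℕ → Set where
  done : ∀ {c} → NonNeg r s c [] c
  up   : ∀ {c w e} → NonNeg r s (c + r) w e → NonNeg r s c (H ∷ w) e
  down : ∀ {c c′ w e} → c ≡ c′ + s → NonNeg r s c′ w e → NonNeg r s c (V ∷ w) e

-- Follows − f up to a constant, that is, r + s − f along a path, or f along a path read backwards.
data Pos (r s : ℕ) : ℕ → Word → ℕ → Set where
  done : ∀ {c} → Pos r s c [] c
  up   : ∀ {c w e} → Pos r s (c + s) w e → Pos r s c (V ∷ w) e
  down : ∀ {c c′ w e} → c ≡ c′ + r → 0 < c′ → Pos r s c′ w e → Pos r s c (H ∷ w) e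

NonNeg-count : ∀ {r s c w e} → NonNeg r s c w e → c + r * #H w ≡ e + s * #V w
NonNeg-count {r} {s} {c} done = trans (cong (c +_) (*-zeroʳ r)) (sym (cong (c +_) (*-zeroʳ s)))
NonNeg-count {r} {s} {c} {H ∷ w} (up p) = trans (lemma c r (#H w)) (NonNeg-count p)
  where
  lemma : ∀ c r n → c + r * suc n ≡ c + r + r * n
  lemma = solve-∀
NonNeg-count {r} {s} {c} {V ∷ w} {e} (down {c′ = c′} refl p) =
  trans (left c′ s (r * #H w)) (trans (cong (_+ s) (NonNeg-count p)) (right e s (#V w)))
  where
  left : ∀ c s n → c + s + n ≡ c + n + s
  left = solve-∀
  right : ∀ e s n → e + s * n + s ≡ e + s * suc n
  right = solve-∀

Pos-count : ∀ {r s c w e} → Pos r s c w e → c + s * #V w ≡ e + r * #H w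
Pos-count {r} {s} {c} done = trans (cong (c +_) (*-zeroʳ s)) (sym (cong (c +_) (*-zeroʳ r)))
Pos-count {r} {s} {c} {V ∷ w} (up p) = trans (lemma c s (#V w)) (Pos-count p)
  where
  lemma : ∀ c r n → c + r * suc n ≡ c + r + r * n
  lemma = solve-∀
Pos-count {r} {s} {c} {H ∷ w} {e} (down {c′ = c′} refl _ p) =
  trans (left c′ r (s * #V w)) (trans (cong (_+ r) (Pos-count p)) (right e r (#H w)))
  where
  left : ∀ c s n → c + s + n ≡ c + n + s
  left = solve-∀
  right : ∀ e s n → e + s * n + s ≡ e + s * suc n
  right = solve-∀

NonNeg-shift : ∀ {r s c w e} k → NonNeg r s c w e → NonNeg r s (k + c) w (k + e)
NonNeg-shift k done = done
NonNeg-shift {r} {s} {c} {H ∷ w} {e} k (up p) =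
  up (subst (λ z → NonNeg r s z w (k + e)) (sym (+-assoc k c r)) (NonNeg-shift k p))
NonNeg-shift {s = s} k (down {c′ = c′} refl p) = down (sym (+-assoc k c′ s)) (NonNeg-shift k p)

-- In `firstMinimum` the part before the minimum is read from the minimum back to the start, so a
-- letter put in front of the path is appended to it at the end.
Pos-snocV : ∀ {r s c w e} → Pos r s c w e → Pos r s c (w ++ V ∷ []) (e + s)
Pos-snocV done = up done
Pos-snocV (up p) = up (Pos-snocV p)
Pos-snocV (down e q p) = down e q (Pos-snocV p)

Pos-snocH : ∀ {r s c w e} → 0 < e → Pos r s c w (e + r) → Pos r s c (w ++ H ∷ []) e
Pos-snocH 0<e done = down refl 0<e done
Pos-snocH 0<e (up p) = up (Pos-snocH 0<e p)
Pos-snocH 0<e (down e q p) = down e q (Pos-snocH 0<e p)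

-- The letters before the first minimum of f are stored in reverse order.
record FirstMinimum (r s : ℕ) (w : Word) : Set where
  field
    {depth end} : ℕ
    {before after} : Word
    split : w ≡ before ʳ++ after
    beforePos : Pos r s 0 before depth
    afterNonNeg : NonNeg r s 0 after end
    allNonNeg : NonNeg r s depth w end

firstMinimum : ∀ r s w → FirstMinimum r s w
firstMinimum r s [] = record { split = refl ; before = [] ; beforePos = done ; afterNonNeg = done ; allNonNeg = done }
firstMinimum r s (V ∷ w) = record
  { before = before ++ V ∷ []
  ; split = trans (cong (V ∷_) split) (sym (++-ʳ++ before))
  ; beforePos = Pos-snocV beforePos
  ; afterNonNeg = afterNonNeg
  ; allNonNeg = down refl allNonNeg }
  where open FirstMinimum (firstMinimum r s w)
firstMinimum r s (H ∷ w) with firstMinimum r s w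
... | F with FirstMinimum.depth F ≤? r
-- The later minimum lies r - `depth` above the start, so the start itself becomes the first
-- minimum; a tie also goes to the start.
... | yes d≤r = record { before = [] ; split = refl ; beforePos = done ; afterNonNeg = all ; allNonNeg = all }
  where
  open FirstMinimum F
  all : NonNeg r s 0 (H ∷ w) (r ∸ depth + end)
  all = up (subst (λ z → NonNeg r s z w (r ∸ depth + end)) (m∸n+n≡m d≤r) (NonNeg-shift (r ∸ depth) allNonNeg))
... | no d≰r = record
  { depth = depth ∸ r
  ; before = before ++ H ∷ []
  ; split = trans (cong (H ∷_) split) (sym (++-ʳ++ before))
  ; beforePos = Pos-snocH (m<n⇒0<n∸m (≰⇒> d≰r)) (subst (Pos r s 0 before) (sym eq) beforePos)
  ; afterNonNeg = afterNonNeg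
  ; allNonNeg = up (subst (λ z → NonNeg r s z w _) (sym eq) allNonNeg) }
  where
  open FirstMinimum F
  eq : depth ∸ r + r ≡ depth
  eq = m∸n+n≡m (<⇒≤ (≰⇒> d≰r))

-- Minimality of the Christoffel word

sum-exceeds : ∀ {a b c d} → c < a → d ≤ b → a + b ≢ c + d
sum-exceeds c<a d≤b eq = <⇒≢ (+-mono-<-≤ c<a d≤b) (sym eq)

-- At the first mismatch, the wrong letters would lead to two points whose heights over
-- the minimum have a sum larger than the conserved value r + s.
backward≼forward : ∀ {r s c c′ u v e e′} → c + c′ ≡ r + s → r < e → s < e′ →
  Pos r s c u e → NonNeg r s c′ v e′ → u ≼ v
backward≼forward eq r<e s<e′ done done = []≼[]
backward≼forward eq r<e s<e′ done (up q) = []≼H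
backward≼forward eq r<e s<e′ done (down refl q) = ⊥-elim (sum-exceeds r<e (m≤n+m _ _) eq)
backward≼forward eq r<e s<e′ (up p) done = V≼[]
backward≼forward eq r<e s<e′ (up p) (up q) = V≼H
backward≼forward {r} {s} {c} eq r<e s<e′ (up p) (down {c′ = c′} refl q) =
  cons V (backward≼forward (trans (lemma c s c′) eq) r<e s<e′ p q)
  where
  lemma : ∀ c s c′ → c + s + c′ ≡ c + (c′ + s)
  lemma = solve-∀
backward≼forward {r} {s} eq r<e s<e′ (down {c′ = c} refl 0<c p) done =
  ⊥-elim (sum-exceeds (m<n+m r 0<c) (<⇒≤ s<e′) eq)
backward≼forward {r} {s} {c′ = c′} eq r<e s<e′ (down {c′ = c} refl 0<c p) (up q) =
  cons H (backward≼forward (trans (lemma c r c′) eq) r<e s<e′ p q)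
  where
  lemma : ∀ c r c′ → c + (c′ + r) ≡ c + r + c′
  lemma = solve-∀
backward≼forward {r} {s} eq r<e s<e′ (down {c′ = c} refl 0<c p) (down refl q) =
  ⊥-elim (sum-exceeds (m<n+m r 0<c) (m≤n+m _ _) eq)

-- Allows an exchange inside a word: what follows the prefix may be replaced by any other path from
-- the value `mid`, and `count` determines that value.
record Splitting (r s c : ℕ) (u v : Word) (e : ℕ) : Set where
  field
    mid : ℕ
    count : c + s * #V u ≡ mid + r * #H u
    tail : Pos r s mid v e
    replace : ∀ {v′ e′} → Pos r s mid v′ e′ → Pos r s c (u ʳ++ v′) e′

Pos-split : ∀ {r s c} u {v e} → Pos r s c (u ʳ++ v) e → Splitting r s c u v e
Pos-split {r} {s} {c} [] p = record
  { count = trans (cong (c +_) (*-zeroʳ s)) (sym (cong (c +_) (*-zeroʳ r))) ; tail = p ; replace = λ q → q }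
Pos-split {r} {s} {c} (V ∷ u) p with Pos-split u p
... | record { mid = m₀ ; count = cnt ; tail = up t ; replace = rep } = record
  { count = trans (left c s (#V u)) (trans (cong (_+ s) cnt) (right m₀ s (r * #H u))) ; tail = t ; replace = λ q → rep (up q) }
  where
  left : ∀ c s n → c + s * suc n ≡ c + s * n + s
  left = solve-∀
  right : ∀ m s n → m + n + s ≡ m + s + n
  right = solve-∀
Pos-split {r} {s} {c} (H ∷ u) p with Pos-split u p
... | record { count = cnt ; tail = down {c′ = m₀} refl pos t ; replace = rep } = record
  { count = trans cnt (right m₀ r (#H u)) ; tail = t ; replace = λ q → rep (down refl pos q) }
  where
  right : ∀ m r n → m + r + r * n ≡ m + r * suc n
  right = solve-∀

-- From (k + 1 , h) with c = r k − s h, along the path L_{r/s} through n east steps.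
greedy : (r s n c : ℕ) → Word
greedy r s zero c = []
greedy r s (suc n) c with s ≤? c + r
... | yes _ = V ∷ H ∷ greedy r s n (c + r ∸ s)
... | no _  = H ∷ greedy r s n (c + r)

-- As c + c′ = s, the two path hypotheses follow f and r + s - f along the same word, so 0 ≤ f < r +
-- s. This forces the next letter: V if s ≤ f, and H if f < s. By r ≤ s there are never two V in a
-- row.
greedy-unique : ∀ {r s} → r ≤ s → ∀ n {c c′} w → c + c′ ≡ s → 0 < c′ → #H w ≡ n →
  NonNeg r s (c + r) w s → Pos r s c′ w r → w ≡ greedy r s n c
greedy-unique r≤s zero [] _ _ _ _ _ = refl
greedy-unique {r} {s} r≤s zero {c} {c′} (V ∷ w) c+c′≡s 0<c′ noH (down {c′ = d} eq p) _ =
  ⊥-elim (<-irrefl eq (begin-strict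
    c + r   <⟨ +-monoˡ-< r (subst (c <_) c+c′≡s (m<m+n c 0<c′)) ⟩
    s + r   ≤⟨ +-monoʳ-≤ s r≤s ⟩
    s + s   ≤⟨ +-monoˡ-≤ s s≤d ⟩
    d + s   ∎))
  where
  open ≤-Reasoning
  s≤d : s ≤ d
  d≡ : s + s * #V w ≡ d
  d≡ = begin-equality
    s + s * #V w  ≡⟨ NonNeg-count p ⟨
    d + r * #H w  ≡⟨ cong (λ n → d + r * n) noH ⟩
    d + r * 0     ≡⟨ cong (d +_) (*-zeroʳ r) ⟩
    d + 0         ≡⟨ +-identityʳ d ⟩
    d             ∎
  s≤d = subst (s ≤_) d≡ (m≤m+n s (s * #V w))
greedy-unique {r} {s} r≤s (suc n) {c} {c′} (H ∷ w) c+c′≡s 0<c′ count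
  (up p) (down {c′ = c″} refl 0<c″ q) with s ≤? c + r
... | yes s≤c+r = ⊥-elim (<-irrefl (sym (trans (lemma c r c″) c+c′≡s)) (≤-<-trans s≤c+r (m<m+n (c + r) 0<c″)))
  where
  lemma : ∀ c r c″ → c + r + c″ ≡ c + (c″ + r)
  lemma = solve-∀
... | no _ = cong (H ∷_) (greedy-unique r≤s n w (trans (lemma c r c″) c+c′≡s) 0<c″ (suc-injective count) p q)
  where
  lemma : ∀ c r c″ → c + r + c″ ≡ c + (c″ + r)
  lemma = solve-∀
greedy-unique {r} {s} r≤s (suc n) {c} {c′} (V ∷ V ∷ w) c+c′≡s 0<c′ _ (down eq (down {c′ = d} refl p)) _ =
  ⊥-elim (<-irrefl eq (begin-strict
    c + r      <⟨ +-monoˡ-< r (subst (c <_) c+c′≡s (m<m+n c 0<c′)) ⟩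
    s + r      ≤⟨ +-monoʳ-≤ s r≤s ⟩
    s + s      ≤⟨ +-monoˡ-≤ s (m≤n+m s d) ⟩
    d + s + s  ∎))
  where open ≤-Reasoning
greedy-unique {r} {s} r≤s (suc n) {c} {c′} (V ∷ H ∷ w) c+c′≡s 0<c′ count
  (down {c′ = d} eq (up p)) (up (down {c′ = c″} eq′ 0<c″ q)) with s ≤? c + r
... | yes _ = cong (λ u → V ∷ H ∷ u)
  (subst (λ z → w ≡ greedy r s n z) (sym (trans (cong (_∸ s) eq) (m+n∸n≡m d s)))
    (greedy-unique r≤s n w d+c″≡s 0<c″ (suc-injective count) p q))
  where
  lemma₁ : ∀ d c″ r s → d + c″ + (r + s) ≡ d + s + (c″ + r)
  lemma₁ = solve-∀
  lemma₂ : ∀ c c′ r s → c + r + (c′ + s) ≡ c + c′ + (r + s)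
  lemma₂ = solve-∀
  d+c″≡s : d + c″ ≡ s
  d+c″≡s = trans (+-cancelʳ-≡ (r + s) (d + c″) (c + c′)
    (trans (lemma₁ d c″ r s) (trans (cong₂ _+_ (sym eq) (sym eq′)) (lemma₂ c c′ r s)))) c+c′≡s
... | no s≰c+r = ⊥-elim (s≰c+r (subst (s ≤_) (sym eq) (m≤n+m s d)))

-- L_{r/s} without its first east and last north step.
christoffel : ℕ → ℕ → Word
christoffel r zero = []
christoffel r (suc s) = greedy r (suc s) s 0

-- The `Pos` hypothesis describes a path from f = r at (1 , 0) to f = s at (s , r - 1) with f < r +
-- s. The induction is on the number of inversions and ends when f is nowhere negative.
christoffel-minimal : ∀ {r s w} → 0 < r → r ≤ s → Pos r s s w r → suc (#H w) ≡ s → weight (christoffel r s) ≤ weight w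
christoffel-minimal {r} {s@(suc s₀)} {w} 0<r r≤s p count = go w (<-wellFounded (inversions w)) p (suc-injective count)
  where
  go : ∀ w → Acc _<_ (inversions w) → Pos r s s w r → #H w ≡ s₀ → weight (christoffel r s) ≤ weight w
  go w (acc smaller) p count with firstMinimum r s w
  ... | F with FirstMinimum.depth F ≤? r
  -- The minimum of f is r - `depth`, so f ≥ 0 throughout and the word is forced.
  ... | yes d≤r = ≤-reflexive (cong weight (sym (greedy-unique r≤s s₀ w refl z<s count nonNeg p)))
    where
    open FirstMinimum F
    k = r ∸ depth
    lowNonNeg : NonNeg r s r w (k + end)
    lowNonNeg = subst (λ z → NonNeg r s z w (k + end)) (m∸n+n≡m d≤r) (NonNeg-shift k allNonNeg)
    nonNeg : NonNeg r s r w s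
    nonNeg = subst (NonNeg r s r w)
      (+-cancelʳ-≡ (s * #V w) (k + end) s (trans (sym (NonNeg-count lowNonNeg)) (sym (Pos-count p)))) lowNonNeg
  ... | no d≰r = flip split beforePos afterNonNeg
    where
    open FirstMinimum F
    r<d : r < depth
    r<d = ≰⇒> d≰r
    depth+s≡end+r : depth + s ≡ end + r
    depth+s≡end+r = +-cancelʳ-≡ (r * #H w + s * #V w) (depth + s) (end + r)
      (trans (left depth s (r * #H w) (s * #V w))
        (trans (cong₂ _+_ (NonNeg-count allNonNeg) (Pos-count p)) (right end r (r * #H w) (s * #V w))))
      where
      left : ∀ d s x y → d + s + (x + y) ≡ (d + x) + (s + y)
      left = solve-∀
      right : ∀ d s x y → (d + y) + (s + x) ≡ d + s + (x + y)
      right = solve-∀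
    s<end : s < end
    s<end = +-cancelʳ-< r s end (subst₂ _<_ (+-comm r s) depth+s≡end+r (+-monoˡ-< s r<d))
    flip : ∀ {u v} → w ≡ u ʳ++ v → Pos r s 0 u depth → NonNeg r s 0 v end → weight (christoffel r s) ≤ weight w
    -- The letter before the minimum must be V and the letter after it H: an empty side contradicts
    -- `r<d` or `s<end`, and any other letter contradicts the choice of the first minimum.
    flip eq done _ = ⊥-elim (n≮0 r<d)
    flip eq (down {c′ = suc _} () _ _) _
    flip eq (up _) done = ⊥-elim (n≮0 s<end)
    flip eq (up _) (down {c′ = c} 0≡c+s _) = ⊥-elim (<-irrefl 0≡c+s (<-≤-trans z<s (m≤n+m s c)))
    flip {V ∷ u} {H ∷ v} refl (up pu) (up nv) =
      ≤-trans (go w′ (smaller (inversions-ʳ++-< u refl ≤-refl)) p′ (trans (#H-ʳ++ u refl) count))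
              (weight-swap-≤ (backward≼forward (+-comm s r) r<d s<end pu nv))
      where
      w′ = u ʳ++ (H ∷ V ∷ v)
      p′ : Pos r s s w′ r
      p′ with Pos-split u p
      ... | record { mid = mid ; count = cnt ; tail = up (down {c′ = c′} eq 0<c′ t) ; replace = replace } =
        -- After the new H the value of r + s - f is `depth` - r, positive because the minimum of f
        -- is negative; after the following V the old path is rejoined.
        replace (down (sym mid≡) (m<n⇒0<n∸m r<d) (up (subst (λ z → Pos r s z v r) (sym eq₂) t)))
        where
        mid≡depth : mid ≡ depth
        mid≡depth = +-cancelʳ-≡ (r * #H u) mid depth (trans (sym cnt) (Pos-count pu))
        mid≡ : depth ∸ r + r ≡ mid
        mid≡ = trans (m∸n+n≡m (<⇒≤ r<d)) (sym mid≡depth)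
        eq₂ : depth ∸ r + s ≡ c′
        eq₂ = +-cancelʳ-≡ r _ _ (trans (lemma (depth ∸ r) s r) (trans (cong (_+ s) mid≡) eq))
          where
          lemma : ∀ x s r → x + s + r ≡ x + r + s
          lemma = solve-∀

greedy-#H : ∀ r s n c → #H (greedy r s n c) ≡ n
greedy-#H r s zero c = refl
greedy-#H r s (suc n) c with s ≤? c + r
... | yes _ = cong suc (greedy-#H r s n (c + r ∸ s))
... | no _  = cong suc (greedy-#H r s n (c + r))

-- The recursion locates the final value only within 0 < e ≤ s; its residue modulo s then identifies
-- it in `christoffel-Pos`.
greedy-Pos : ∀ {r s} → r ≤ s → ∀ n {c c′} → c + c′ ≡ s → 0 < c′ → ∃[ e ] (Pos r s c′ (greedy r s n c) e × 0 < e × e ≤ s)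
greedy-Pos r≤s zero {c} {c′} eq 0<c′ = c′ , done , 0<c′ , subst (c′ ≤_) eq (m≤n+m c′ c)
greedy-Pos {r} {s} r≤s (suc n) {c} {c′} eq 0<c′ with s ≤? c + r
... | yes s≤c+r with greedy-Pos r≤s n {c + r ∸ s} {c′ + s ∸ r} sum≡s 0<c″
  where
  r≤c′+s : r ≤ c′ + s
  r≤c′+s = ≤-trans r≤s (m≤n+m s c′)
  0<c″ : 0 < c′ + s ∸ r
  0<c″ = m<n⇒0<n∸m (≤-<-trans r≤s (m<n+m s 0<c′))
  left : ∀ x y r s → (x + y) + (s + r) ≡ (x + s) + (y + r)
  left = solve-∀
  right : ∀ c c′ r s → (c + r) + (c′ + s) ≡ (c + c′) + (s + r)
  right = solve-∀
  sum≡s : c + r ∸ s + (c′ + s ∸ r) ≡ s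
  sum≡s = trans (+-cancelʳ-≡ (s + r) _ (c + c′)
    (trans (left (c + r ∸ s) (c′ + s ∸ r) r s) (trans (cong₂ _+_ (m∸n+n≡m s≤c+r) (m∸n+n≡m r≤c′+s)) (right c c′ r s)))) eq
...   | e , p , q = e , up (down (sym (m∸n+n≡m (≤-trans r≤s (m≤n+m s c′)))) (m<n⇒0<n∸m (≤-<-trans r≤s (m<n+m s 0<c′))) p) , q
greedy-Pos {r} {s} r≤s (suc n) {c} {c′} eq 0<c′ | no s≰c+r with greedy-Pos r≤s n {c + r} {c′ ∸ r} sum≡s (m<n⇒0<n∸m r<c′)
  where
  r<c′ : r < c′
  r<c′ = +-cancelˡ-< c r c′ (subst (c + r <_) (sym eq) (≰⇒> s≰c+r))
  sum≡s : c + r + (c′ ∸ r) ≡ s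
  sum≡s = trans (+-assoc c r (c′ ∸ r)) (trans (cong (c +_) (m+[n∸m]≡n (<⇒≤ r<c′))) eq)
... | e , p , q = e , down (sym (m∸n+n≡m (<⇒≤ r<c′))) (m<n⇒0<n∸m r<c′) p , q
  where
  r<c′ : r < c′
  r<c′ = +-cancelˡ-< c r c′ (subst (c + r <_) (sym eq) (≰⇒> s≰c+r))

residue-unique : ∀ {e r s} → 0 < e → e ≤ s → 0 < r → r ≤ s → ∀ j k → e + s * j ≡ r + s * k → e ≡ r
residue-unique {e} {r} {s} 0<e e≤s 0<r r≤s zero zero eq = +-cancelʳ-≡ (s * 0) e r eq
residue-unique {e} {r} {s} 0<e e≤s 0<r r≤s zero (suc k) eq = ⊥-elim (<-irrefl eq (begin-strict
  e + s * 0      ≡⟨ trans (cong (e +_) (*-zeroʳ s)) (+-identityʳ e) ⟩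
  e              ≤⟨ e≤s ⟩
  s              <⟨ m<n+m s 0<r ⟩
  r + s          ≤⟨ +-monoʳ-≤ r (m≤m*n s (suc k)) ⟩
  r + s * suc k  ∎))
  where open ≤-Reasoning
residue-unique {e} {r} {s} 0<e e≤s 0<r r≤s (suc j) zero eq = sym (residue-unique 0<r r≤s 0<e e≤s zero (suc j) (sym eq))
residue-unique {e} {r} {s} 0<e e≤s 0<r r≤s (suc j) (suc k) eq = residue-unique 0<e e≤s 0<r r≤s j k
  (+-cancelʳ-≡ s _ _ (trans (lemma e s j) (trans eq (sym (lemma r s k)))))
  where
  lemma : ∀ e s j → e + s * j + s ≡ e + s * suc j
  lemma = solve-∀

christoffel-#H : ∀ r s → suc (#H (christoffel r (suc s))) ≡ suc s
christoffel-#H r s = cong suc (greedy-#H r (suc s) s 0)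

christoffel-Pos : ∀ {r s} → 0 < r → r ≤ s → Pos r s s (christoffel r s) r
christoffel-Pos {r} {zero} 0<r r≤0 = ⊥-elim (n≮0 (<-≤-trans 0<r r≤0))
christoffel-Pos {r} {suc s} 0<r r≤s with greedy-Pos r≤s s {0} refl z<s
... | e , p , 0<e , e≤s = subst (Pos r (suc s) (suc s) w) (residue-unique 0<e e≤s 0<r r≤s r (suc (#V w)) eq) p
  where
  w = greedy r (suc s) s 0
  left : ∀ e r s → e + suc s * r ≡ r + (e + r * s)
  left = solve-∀
  right : ∀ r s v → r + (suc s + suc s * v) ≡ r + suc s * suc v
  right = solve-∀
  eq : e + suc s * r ≡ r + suc s * suc (#V w)
  eq = begin
    e + suc s * r                  ≡⟨ left e r s ⟩
    r + (e + r * s)                ≡⟨ cong (λ n → r + (e + r * n)) (greedy-#H r (suc s) s 0) ⟨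
    r + (e + r * #H w)             ≡⟨ cong (r +_) (Pos-count p) ⟨
    r + (suc s + suc s * #V w)     ≡⟨ right r s (#V w) ⟩
    r + suc s * suc (#V w)         ∎
    where open ≡-Reasoning

-- Deletion of a letter and strict monotonicity

Pos⇒#V : ∀ {r s w} → Pos r s s w r → suc (#H w) ≡ s → suc (#V w) ≡ r
Pos⇒#V {r} {s@(suc _)} {w} p eq = *-cancelˡ-≡ _ _ s (begin
  s * suc (#V w)  ≡⟨ *-suc s (#V w) ⟩
  s + s * #V w    ≡⟨ Pos-count p ⟩
  r + r * #H w    ≡⟨ *-suc r (#H w) ⟨
  r * suc (#H w)  ≡⟨ cong (r *_) eq ⟩
  r * s           ≡⟨ *-comm r s ⟩
  s * r           ∎)
  where open ≡-Reasoning

-- Each V now rises by one less, so a value must grow by the number of V still to come if the end is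
-- to stay the same. Larger values remain positive.
Pos-lowerRise : ∀ {r s c w e} → Pos r (suc s) c w e → Pos r s (c + #V w) w e
Pos-lowerRise {r} {s} {c} done = subst (λ z → Pos r s z [] c) (sym (+-identityʳ c)) done
Pos-lowerRise {r} {s} {c} {V ∷ w} {e} (up p) = up (subst (λ z → Pos r s z w e) (lemma c s (#V w)) (Pos-lowerRise p))
  where
  lemma : ∀ c s n → c + suc s + n ≡ c + suc n + s
  lemma = solve-∀
Pos-lowerRise {r} {s} {c} {H ∷ w} {e} (down {c′ = c′} refl 0<c′ p) =
  down (lemma c′ r (#V w)) (<-≤-trans 0<c′ (m≤m+n c′ _)) (Pos-lowerRise p)
  where
  lemma : ∀ c s n → c + s + n ≡ c + n + s
  lemma = solve-∀

Pos-noV : ∀ {r s} → 0 < r → ∀ w → #V w ≡ 0 → ∀ {c} → c ≡ r + r * #H w → Pos r s c w r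
Pos-noV {r} {s} 0<r [] _ eq = subst (λ z → Pos r s z [] r) (sym (trans eq (trans (cong (r +_) (*-zeroʳ r)) (+-identityʳ r)))) done
Pos-noV {r} 0<r (H ∷ w) noV eq = down (trans eq (lemma r (#H w))) (<-≤-trans 0<r (m≤m+n r _)) (Pos-noV 0<r w noV refl)
  where
  lemma : ∀ r n → r + r * suc n ≡ r + r * n + r
  lemma = solve-∀

-- The word is w without its last V; c grows by the abscissa, since each H lowers it by one less.
Pos-deleteV : ∀ {r s} → 0 < r → ∀ w {n c y e} → #V w ≡ suc n → Pos (suc r) s c w e → c + y + s * n ≡ r + r * #H w →
  ∃[ w′ ] (#H w′ ≡ #H w × Pos r s (c + y) w′ r × val w′ ≪ val w)
Pos-deleteV {r} {s} 0<r (H ∷ w) {n} {y = y} #V≡ (down {c′ = c} refl 0<c p) total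
  with Pos-deleteV 0<r w {n} {c} {suc y} #V≡ p (+-cancelʳ-≡ r _ _ (trans (left c y r (s * n)) (trans total (right r (#H w)))))
  where
  left : ∀ c y r z → c + suc y + z + r ≡ c + suc r + y + z
  left = solve-∀
  right : ∀ r n → r + r * suc n ≡ r + r * n + r
  right = solve-∀
... | w′ , #H≡ , q , lt = H ∷ w′ , cong suc #H≡ , down (lemma c y r) (<-≤-trans 0<c (m≤m+n c _)) q , double-≪ H lt
  where
  lemma : ∀ c y r → c + suc r + y ≡ c + suc y + r
  lemma = solve-∀
-- This V is the last one. Without it the path descends in steps of r to the final value r, so it
-- stays positive.
Pos-deleteV {r} {s} 0<r (V ∷ w) {zero} {c} {y} #V≡ (up p) total =
  w , refl
  , Pos-noV 0<r w (suc-injective #V≡) (trans (sym (trans (cong (c + y +_) (*-zeroʳ s)) (+-identityʳ (c + y)))) total)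
  , ≪-double V (val-positive w)
Pos-deleteV {r} {s} 0<r (V ∷ w) {suc n} {c} {y} #V≡ (up p) total
  with Pos-deleteV 0<r w {n} {c + s} {y} (suc-injective #V≡) p (trans (left c y s n) total)
  where
  left : ∀ c y s n → c + s + y + s * n ≡ c + y + s * suc n
  left = solve-∀
... | w′ , #H≡ , q , lt = V ∷ w′ , #H≡ , up (subst (λ z → Pos r s z w′ r) (lemma c s y) q) , double-≪ V lt
  where
  lemma : ∀ c s y → c + s + y ≡ c + y + s
  lemma = solve-∀

christoffel-<-denominator : ∀ {p q} → 0 < p → p < q → weight (christoffel p q) < weight (christoffel p (suc q))
christoffel-<-denominator {p} {suc q} 0<p p<q = go (christoffel p (2 + q)) startsH (christoffel-Pos 0<p p≤) (christoffel-#H p (suc q))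
  where
  p≤ : p ≤ 2 + q
  p≤ = ≤-trans (<⇒≤ p<q) (n≤1+n _)
  -- At (1 , 0) the value f = p is below the denominator, so the first step goes east.
  startsH : ∃[ w ] christoffel p (2 + q) ≡ H ∷ w
  startsH with (2 + q) ≤? p
  ... | yes q≤p = ⊥-elim (<-irrefl refl (<-trans p<q q≤p))
  ... | no _ = _ , refl
  go : ∀ w → ∃[ w′ ] w ≡ H ∷ w′ → Pos p (2 + q) (2 + q) w p → suc (#H w) ≡ 2 + q → weight (christoffel p (suc q)) < weight w
  go _ (w , refl) pos@(down {c′ = c} eq 0<c rest) count =
    ≤-<-trans
      (christoffel-minimal 0<p (<⇒≤ p<q) (subst (λ z → Pos p (suc q) z w p) c+v≡ (Pos-lowerRise rest)) (suc-injective count))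
      (weight-< {w} {H ∷ w} (≪-double H (val-positive w)))
    where
    -- Here c = 2 + q - p and w has p - 1 letters V, so the lowered path starts at the denominator 1
    -- + q.
    c+v≡ : c + #V w ≡ suc q
    c+v≡ = suc-injective (trans (sym (+-suc c (#V w))) (trans (cong (c +_) (Pos⇒#V pos count)) (sym eq)))

christoffel-<-numerator : ∀ {p q} → 0 < p → p < q → weight (christoffel p q) < weight (christoffel (suc p) q)
christoffel-<-numerator {p@(suc p₀)} {suc q} 0<p p<q = result
  where
  w = christoffel (suc p) (suc q)
  count = christoffel-#H (suc p) q
  pos : Pos (suc p) (suc q) (suc q) w (suc p)
  pos = christoffel-Pos z<s p<q
  lemma : ∀ q p → suc q + 0 + suc q * p ≡ suc p + suc p * q
  lemma = solve-∀
  result : weight (christoffel p (suc q)) < weight w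
  result with Pos-deleteV 0<p w {p₀} {suc q} {0} (suc-injective (Pos⇒#V pos count)) pos
                (trans (lemma q p₀) (cong (λ n → p + p * n) (sym (suc-injective count))))
  ... | w′ , #H≡ , pos′ , lt = ≤-<-trans
    (christoffel-minimal 0<p (<⇒≤ p<q) (subst (λ z → Pos p (suc q) z w′ p) (+-identityʳ (suc q)) pos′)
      (trans (cong suc #H≡) count))
    (weight-< {w′} {w} lt)

-- Counting sublists and perfect matchings

module _ {A : Set} where

  countSublists : {P : Pred (List A) 0ℓ} → Decidable P → List A → ℕ
  countSublists P? xs = length (filter P? (sublists xs))

  length-filter-map : {B : Set} {P : Pred B 0ℓ} (P? : Decidable P) (f : A → B) (xs : List A) →
    length (filter P? (map f xs)) ≡ length (filter (P? ∘ f) xs)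
  length-filter-map P? f [] = refl
  length-filter-map P? f (x ∷ xs) with does (P? (f x))
  ... | true = cong suc (length-filter-map P? f xs)
  ... | false = length-filter-map P? f xs

module _ {A : Set} where

  count-∷ : {P : Pred (List A) 0ℓ} (P? : Decidable P) (x : A) (xs : List A) →
    countSublists P? (x ∷ xs) ≡ countSublists P? xs + countSublists (P? ∘ (x ∷_)) xs
  count-∷ P? x xs = begin
    length (filter P? (ys ++ map (x ∷_) ys))                       ≡⟨ cong length (filter-++ P? ys (map (x ∷_) ys)) ⟩
    length (filter P? ys ++ filter P? (map (x ∷_) ys))             ≡⟨ length-++ (filter P? ys) ⟩
    length (filter P? ys) + length (filter P? (map (x ∷_) ys))     ≡⟨ cong (length (filter P? ys) +_) (length-filter-map P? (x ∷_) ys) ⟩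
    length (filter P? ys) + length (filter (P? ∘ (x ∷_)) ys)       ∎
    where
    open ≡-Reasoning
    ys = sublists xs

  count-cong : {P Q : Pred (List A) 0ℓ} (P? : Decidable P) (Q? : Decidable Q) (xs : List A) →
    (∀ M → M ⊆ xs → P M → Q M) → (∀ M → M ⊆ xs → Q M → P M) → countSublists P? xs ≡ countSublists Q? xs
  count-cong P? Q? [] to from with P? [] | Q? []
  ... | yes _ | yes _ = refl
  ... | no _  | no _  = refl
  ... | yes p | no ¬q = ⊥-elim (¬q (to [] (λ ()) p))
  ... | no ¬p | yes q = ⊥-elim (¬p (from [] (λ ()) q))
  count-cong P? Q? (x ∷ xs) to from = begin
    countSublists P? (x ∷ xs)                                   ≡⟨ count-∷ P? x xs ⟩
    countSublists P? xs + countSublists (P? ∘ (x ∷_)) xs        ≡⟨ cong₂ _+_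
      (count-cong P? Q? xs (λ M M⊆ → to M (there ∘ M⊆)) (λ M M⊆ → from M (there ∘ M⊆)))
      (count-cong (P? ∘ (x ∷_)) (Q? ∘ (x ∷_)) xs (λ M M⊆ → to (x ∷ M) (x∷ M⊆)) (λ M M⊆ → from (x ∷ M) (x∷ M⊆))) ⟩
    countSublists Q? xs + countSublists (Q? ∘ (x ∷_)) xs        ≡⟨ count-∷ Q? x xs ⟨
    countSublists Q? (x ∷ xs)                                   ∎
    where
    open ≡-Reasoning
    x∷ : ∀ {M} → M ⊆ xs → (x ∷ M) ⊆ (x ∷ xs)
    x∷ M⊆ (here eq) = here eq
    x∷ M⊆ (there i) = there (M⊆ i)

  count-none : {P : Pred (List A) 0ℓ} (P? : Decidable P) (xs : List A) →
    (∀ M → M ⊆ xs → ¬ P M) → countSublists P? xs ≡ 0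
  count-none P? [] none with P? []
  ... | yes p = ⊥-elim (none [] (λ ()) p)
  ... | no _ = refl
  count-none P? (x ∷ xs) none = trans (count-∷ P? x xs) (cong₂ _+_
    (count-none P? xs (λ M M⊆ → none M (there ∘ M⊆)))
    (count-none (P? ∘ (x ∷_)) xs (λ M M⊆ → none (x ∷ M) λ { (here eq) → here eq ; (there i) → there (M⊆ i) })))

  -- `deduplicate` leaves the edges in an order that depends on the tiles, while the gluing argument
  -- needs the new edges in front. For a condition invariant under permutation the order is
  -- immaterial.
  count-↭ : {P : Pred (List A) 0ℓ} (P? : Decidable P) → (∀ {M N} → M ↭ N → P M → P N) →
    ∀ {xs ys} → xs ↭ ys → countSublists P? xs ≡ countSublists P? ys
  count-↭ P? resp ↭.refl = refl
  count-↭ P? resp (↭.trans σ τ) = trans (count-↭ P? resp σ) (count-↭ P? resp τ)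
  count-↭ P? resp {x ∷ xs} {x ∷ ys} (prep x σ) = trans (count-∷ P? x xs) (trans
    (cong₂ _+_ (count-↭ P? resp σ) (count-↭ (P? ∘ (x ∷_)) (resp ∘ prep x) σ))
    (sym (count-∷ P? x ys)))
  count-↭ P? resp {x ∷ y ∷ xs} {y ∷ x ∷ ys} (swap x y σ) = begin
    countSublists P? (x ∷ y ∷ xs)  ≡⟨ expand x y xs ⟩
    (c P? xs + c (P? ∘ (y ∷_)) xs) + (c (P? ∘ (x ∷_)) xs + c (P? ∘ (x ∷_) ∘ (y ∷_)) xs)
      ≡⟨ +-interchange (c P? xs) _ _ _ ⟩
    (c P? xs + c (P? ∘ (x ∷_)) xs) + (c (P? ∘ (y ∷_)) xs + c (P? ∘ (x ∷_) ∘ (y ∷_)) xs)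
      ≡⟨ cong₂ _+_ (cong₂ _+_ (count-↭ P? resp σ) (count-↭ _ (resp ∘ prep x) σ))
                   (cong₂ _+_ (count-↭ _ (resp ∘ prep y) σ)
                     (trans (count-cong _ (P? ∘ (y ∷_) ∘ (x ∷_)) xs (λ _ _ → resp (swap x y ↭-refl)) (λ _ _ → resp (swap y x ↭-refl)))
                            (count-↭ _ (resp ∘ prep y ∘ prep x) σ))) ⟩
    (c P? ys + c (P? ∘ (x ∷_)) ys) + (c (P? ∘ (y ∷_)) ys + c (P? ∘ (y ∷_) ∘ (x ∷_)) ys)
      ≡⟨ expand y x ys ⟨
    countSublists P? (y ∷ x ∷ ys)  ∎
    where
    open ≡-Reasoning
    c : {Q : Pred (List A) 0ℓ} → Decidable Q → List A → ℕ
    c = countSublists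
    expand : ∀ x y xs → c P? (x ∷ y ∷ xs) ≡
      (c P? xs + c (P? ∘ (y ∷_)) xs) + (c (P? ∘ (x ∷_)) xs + c (P? ∘ (x ∷_) ∘ (y ∷_)) xs)
    expand x y xs = trans (count-∷ P? x (y ∷ xs)) (cong₂ _+_ (count-∷ P? y xs) (count-∷ (P? ∘ (x ∷_)) y xs))
    +-interchange : ∀ a b c d → (a + b) + (c + d) ≡ (a + c) + (b + d)
    +-interchange = solve-∀

  -- In a list without repetitions membership is a proposition, so mutual inclusion is already a
  -- bijection of memberships.
  unique-sameElements⇒↭ : {xs ys : List A} → Unique xs → Unique ys → xs ⊆ ys → ys ⊆ xs → xs ↭ ys
  unique-sameElements⇒↭ u v f g = ∼bag⇒↭ (mk↔ₛ′ f g (λ _ → irr v _ _) (λ _ → irr u _ _))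
    where
    irr : ∀ {xs : List A} → Unique xs → ∀ {x} (p q : x ∈ xs) → p ≡ q
    irr = SetoidMembership.unique⇒irrelevant (setoid A) (λ { refl refl → refl })

-- Vertex degrees and forced edges

degree : Point → List Edge → ℕ
degree v M = length (filter (v ∈ₑ?_) M)

incidence : Point → Edge → ℕ
incidence v e = degree v (e ∷ [])

degree-∷ : ∀ v e M → degree v (e ∷ M) ≡ incidence v e + degree v M
degree-∷ v e M with does (v ∈ₑ? e)
... | true = refl
... | false = refl

degree-++ : ∀ v M N → degree v (M ++ N) ≡ degree v M + degree v N
degree-++ v M N = trans (cong length (filter-++ (v ∈ₑ?_) M N)) (length-++ (filter (v ∈ₑ?_) M))

degree-zero : ∀ v M → (∀ {e} → e ∈ M → ¬ v ∈ₑ e) → degree v M ≡ 0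
degree-zero v M avoid = cong length (filter-none (v ∈ₑ?_) (All.tabulate avoid))

incidence-∈ : ∀ {v e} → v ∈ₑ e → incidence v e ≡ 1
incidence-∈ {v} {e} v∈e rewrite dec-true (v ∈ₑ? e) v∈e = refl

incidence-∉ : ∀ {v e} → ¬ v ∈ₑ e → incidence v e ≡ 0
incidence-∉ {v} {e} v∉e rewrite dec-false (v ∈ₑ? e) v∉e = refl

-- S holds forced edges. If an edge of S also occurs in `es` and an end of it lies in `vs`, it
-- cannot be chosen again, as that end would get degree two; so forcing one such edge counts the
-- perfect matchings that use it.
completions : List Edge → List Point → List Edge → ℕ
completions S vs es = countSublists (λ M → isPerfectMatching? vs (S ++ M)) es

completions-cong : ∀ S {vs vs′ es es′} → vs ⊆ vs′ → vs′ ⊆ vs → es ↭ es′ → completions S vs es ≡ completions S vs′ es′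
completions-cong S {vs} {vs′} {es} {es′} vs⊆ vs⊇ σ = trans
  (count-↭ (λ M → isPerfectMatching? vs (S ++ M)) resp σ)
  (count-cong _ _ es′ (λ _ _ p → All.tabulate (All.lookup p ∘ vs⊇)) (λ _ _ p → All.tabulate (All.lookup p ∘ vs⊆)))
  where
  resp : ∀ {M N} → M ↭ N → IsPerfectMatching vs (S ++ M) → IsPerfectMatching vs (S ++ N)
  resp τ = All.map (λ {v} → trans (sym (↭-length (filter-↭ (v ∈ₑ?_) (++⁺ˡ S τ)))))

-- The three edges which a new tile with new vertices n₁, n₂ adds to the edge x it is
-- glued along: far joins n₁ and n₂, and nearᵢ joins nᵢ to an end of x.
data Side : Set where
  far near₁ near₂ : Side

at₁ at₂ : Side → ℕ
at₁ far = 1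
at₁ near₁ = 1
at₁ near₂ = 0
at₂ far = 1
at₂ near₁ = 0
at₂ near₂ = 1

-- To the old vertices `far` is invisible and the two near edges together look like x, while the old
-- edges miss both new vertices. The counts follow from these incidences alone, for either direction
-- of gluing.
record Gluing (n₁ n₂ : Point) (edge : Side → Edge) (x : Edge) (vs : List Point) (es : List Edge) : Set where
  field
    incidence₁ : ∀ a → incidence n₁ (edge a) ≡ at₁ a
    incidence₂ : ∀ a → incidence n₂ (edge a) ≡ at₂ a
    avoid₁ : ∀ {e} → e ∈ es → ¬ n₁ ∈ₑ e
    avoid₂ : ∀ {e} → e ∈ es → ¬ n₂ ∈ₑ e
    far-old : ∀ {w} → w ∈ vs → incidence w (edge far) ≡ 0
    near-old : ∀ {w} → w ∈ vs → incidence w (edge near₁) + incidence w (edge near₂) ≡ incidence w x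

  newVertices : List Point
  newVertices = n₁ ∷ n₂ ∷ vs

  newEdges : List Edge
  newEdges = edge far ∷ edge near₁ ∷ edge near₂ ∷ es

  private
    term : List Side → ℕ
    term Y = completions (map edge Y) newVertices es

    degree-sides : ∀ n (at : Side → ℕ) → (∀ a → incidence n (edge a) ≡ at a) → ∀ Y → degree n (map edge Y) ≡ sum (map at Y)
    degree-sides n at inc [] = refl
    degree-sides n at inc (a ∷ Y) = trans (degree-∷ n (edge a) (map edge Y)) (cong₂ _+_ (inc a) (degree-sides n at inc Y))

    degree-new : ∀ n (at : Side → ℕ) → (∀ a → incidence n (edge a) ≡ at a) → (∀ {e} → e ∈ es → ¬ n ∈ₑ e) →
      ∀ Y {M} → M ⊆ es → degree n (map edge Y ++ M) ≡ sum (map at Y)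
    degree-new n at inc avoid Y {M} M⊆ = begin
      degree n (map edge Y ++ M)               ≡⟨ degree-++ n (map edge Y) M ⟩
      degree n (map edge Y) + degree n M       ≡⟨ cong₂ _+_ (degree-sides n at inc Y) (degree-zero n M (avoid ∘ M⊆)) ⟩
      sum (map at Y) + 0                       ≡⟨ +-identityʳ _ ⟩
      sum (map at Y)                           ∎
      where open ≡-Reasoning

    dead₁ : ∀ Y → sum (map at₁ Y) ≢ 1 → term Y ≡ 0
    dead₁ Y ne = count-none _ es λ { M M⊆ (d ∷ _) → ne (trans (sym (degree-new n₁ at₁ incidence₁ avoid₁ Y M⊆)) d) }

    dead₂ : ∀ Y → sum (map at₂ Y) ≢ 1 → term Y ≡ 0
    dead₂ Y ne = count-none _ es λ { M M⊆ (_ ∷ d ∷ _) → ne (trans (sym (degree-new n₂ at₂ incidence₂ avoid₂ Y M⊆)) d) }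

    live : ∀ Y S → sum (map at₁ Y) ≡ 1 → sum (map at₂ Y) ≡ 1 → (∀ {w} → w ∈ vs → degree w (map edge Y) ≡ degree w S) →
      term Y ≡ completions S vs es
    live Y S d₁ d₂ same = count-cong _ _ es
      (λ { M _ (_ ∷ _ ∷ p) → All.tabulate λ {w} w∈ → trans (sym (eq w M w∈)) (All.lookup p w∈) })
      (λ M M⊆ p → trans (degree-new n₁ at₁ incidence₁ avoid₁ Y M⊆) d₁
                ∷ trans (degree-new n₂ at₂ incidence₂ avoid₂ Y M⊆) d₂
                ∷ All.tabulate λ {w} w∈ → trans (eq w M w∈) (All.lookup p w∈))
      where
      eq : ∀ w M → w ∈ vs → degree w (map edge Y ++ M) ≡ degree w (S ++ M)
      eq w M w∈ = trans (degree-++ w (map edge Y) M) (trans (cong (_+ degree w M) (same w∈)) (sym (degree-++ w S M)))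

    live-far : term (far ∷ []) ≡ completions [] vs es
    live-far = live (far ∷ []) [] refl refl far-old

    live-near : term (near₁ ∷ near₂ ∷ []) ≡ completions (x ∷ []) vs es
    live-near = live (near₁ ∷ near₂ ∷ []) (x ∷ []) refl refl
      λ {w} w∈ → trans (degree-∷ w (edge near₁) (edge near₂ ∷ [])) (near-old w∈)

    expand : {P : Pred (List Edge) 0ℓ} (P? : Decidable P) (f g h : Edge) → countSublists P? (f ∷ g ∷ h ∷ es) ≡
        ((countSublists P? es + countSublists (P? ∘ (h ∷_)) es)
          + (countSublists (P? ∘ (g ∷_)) es + countSublists (P? ∘ (g ∷_) ∘ (h ∷_)) es))
      + ((countSublists (P? ∘ (f ∷_)) es + countSublists (P? ∘ (f ∷_) ∘ (h ∷_)) es)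
          + (countSublists (P? ∘ (f ∷_) ∘ (g ∷_)) es + countSublists (P? ∘ (f ∷_) ∘ (g ∷_) ∘ (h ∷_)) es))
    expand P? f g h = trans (count-∷ P? f (g ∷ h ∷ es)) (cong₂ _+_ (two P?) (two (P? ∘ (f ∷_))))
      where
      two : {Q : Pred (List Edge) 0ℓ} (Q? : Decidable Q) → countSublists Q? (g ∷ h ∷ es) ≡
        (countSublists Q? es + countSublists (Q? ∘ (h ∷_)) es)
          + (countSublists (Q? ∘ (g ∷_)) es + countSublists (Q? ∘ (g ∷_) ∘ (h ∷_)) es)
      two Q? = trans (count-∷ Q? g (h ∷ es)) (cong₂ _+_ (count-∷ Q? h es) (count-∷ (Q? ∘ (g ∷_)) h es))

  -- Of the eight choices among the new edges, only `far` alone and the two near edges together give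
  -- both new vertices degree one. The first leaves a matching of the old graph, the second one with
  -- x forced.
  completions-[] : completions [] newVertices newEdges ≡ completions (x ∷ []) vs es + completions [] vs es
  completions-[] = trans (expand _ (edge far) (edge near₁) (edge near₂)) (cong₂ _+_
    (cong₂ _+_
      (cong₂ _+_ (dead₁ [] λ ()) (dead₁ (near₂ ∷ []) λ ()))
      (cong₂ _+_ (dead₂ (near₁ ∷ []) λ ()) live-near))
    (trans (cong₂ _+_
      (cong₂ _+_ live-far (dead₂ (far ∷ near₂ ∷ []) λ ()))
      (cong₂ _+_ (dead₁ (far ∷ near₁ ∷ []) λ ()) (dead₁ (far ∷ near₁ ∷ near₂ ∷ []) λ ())))
      (trans (+-identityʳ _) (+-identityʳ _))))

  completions-far : completions (edge far ∷ []) newVertices newEdges ≡ completions [] vs es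
  completions-far = trans (expand _ (edge far) (edge near₁) (edge near₂)) (trans (cong₂ _+_
    (cong₂ _+_
      (cong₂ _+_ live-far (dead₂ (far ∷ near₂ ∷ []) λ ()))
      (cong₂ _+_ (dead₁ (far ∷ near₁ ∷ []) λ ()) (dead₁ (far ∷ near₁ ∷ near₂ ∷ []) λ ())))
    (cong₂ _+_
      (cong₂ _+_ (dead₁ (far ∷ far ∷ []) λ ()) (dead₁ (far ∷ far ∷ near₂ ∷ []) λ ()))
      (cong₂ _+_ (dead₁ (far ∷ far ∷ near₁ ∷ []) λ ()) (dead₁ (far ∷ far ∷ near₁ ∷ near₂ ∷ []) λ ()))))
    (trans (+-identityʳ _) (trans (+-identityʳ _) (+-identityʳ _))))

  completions-near : completions (edge near₁ ∷ []) newVertices newEdges ≡ completions (x ∷ []) vs es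
  completions-near = trans (expand _ (edge far) (edge near₁) (edge near₂)) (trans (cong₂ _+_
    (cong₂ _+_
      (cong₂ _+_ (dead₂ (near₁ ∷ []) λ ()) live-near)
      (cong₂ _+_ (dead₁ (near₁ ∷ near₁ ∷ []) λ ()) (dead₁ (near₁ ∷ near₁ ∷ near₂ ∷ []) λ ())))
    (cong₂ _+_
      (cong₂ _+_ (dead₁ (near₁ ∷ far ∷ []) λ ()) (dead₁ (near₁ ∷ far ∷ near₂ ∷ []) λ ()))
      (cong₂ _+_ (dead₁ (near₁ ∷ far ∷ near₁ ∷ []) λ ()) (dead₁ (near₁ ∷ far ∷ near₁ ∷ near₂ ∷ []) λ ()))))
    (trans (+-identityʳ _) (+-identityʳ _)))

  -- The incidences with n₁ and n₂ tell the three new edges apart, and old edges meet neither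
  -- vertex.
  newEdges-unique : Unique es → Unique newEdges
  newEdges-unique u =
      ((λ eq → 1≢0 (trans (sym (incidence₂ far)) (trans (cong (incidence n₂) eq) (incidence₂ near₁))))
       ∷ (λ eq → 1≢0 (trans (sym (incidence₁ far)) (trans (cong (incidence n₁) eq) (incidence₁ near₂))))
       ∷ fresh (incidence₁ far) avoid₁)
    ∷ ((λ eq → 1≢0 (trans (sym (incidence₁ near₁)) (trans (cong (incidence n₁) eq) (incidence₁ near₂))))
       ∷ fresh (incidence₁ near₁) avoid₁)
    ∷ fresh (incidence₂ near₂) avoid₂
    ∷ u
    where
    1≢0 : 1 ≢ 0
    1≢0 ()
    fresh : ∀ {n e} → incidence n e ≡ 1 → (∀ {e′} → e′ ∈ es → ¬ n ∈ₑ e′) → All (e ≢_) es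
    fresh {n} {e} inc avoid = All.tabulate λ {e′} e′∈ eq →
      1≢0 (trans (sym inc) (trans (cong (incidence n) eq) (incidence-∉ {n} {e′} (avoid e′∈))))

-- Edge sets and the attachment of a tile

edgeSet : List Edge → List Edge
edgeSet = deduplicate _≟E_

edgeSet-unique : ∀ E → Unique (edgeSet E)
edgeSet-unique = UniqueDec.deduplicate-! _≟E_

∈-edgeSet⁺ : ∀ {E e} → e ∈ E → e ∈ edgeSet E
∈-edgeSet⁺ = ∈-deduplicate⁺ _≟E_

∈-edgeSet⁻ : ∀ {E e} → e ∈ edgeSet E → e ∈ E
∈-edgeSet⁻ {E} = ∈-deduplicate⁻ _≟E_ E

completions-edgeSet : ∀ S {vs vs′ E E′} → vs ⊆ vs′ → vs′ ⊆ vs → E ⊆ E′ → E′ ⊆ E →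
  completions S vs (edgeSet E) ≡ completions S vs′ (edgeSet E′)
completions-edgeSet S {E = E} {E′} vs⊆ vs⊇ E⊆ E⊇ = completions-cong S vs⊆ vs⊇
  (unique-sameElements⇒↭ (edgeSet-unique E) (edgeSet-unique E′)
    (∈-edgeSet⁺ ∘ E⊆ ∘ ∈-edgeSet⁻) (∈-edgeSet⁺ ∘ E⊇ ∘ ∈-edgeSet⁻))

incidence-parallel : ∀ {w a u b v} (g h x : Edge) → endpoints g ≡ (a , u) → endpoints h ≡ (b , v) → endpoints x ≡ (u , v) →
  u ≢ v → w ≢ a → w ≢ b → incidence w g + incidence w h ≡ incidence w x
incidence-parallel {w} {a} {u} {b} {v} g h x eg eh ex u≢v w≢a w≢b with w ≟P u | w ≟P v
... | yes refl | yes refl = ⊥-elim (u≢v refl)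
... | yes refl | no w≢v = trans (cong₂ _+_
  (incidence-∈ {w} {g} (inj₂ (sym (cong proj₂ eg))))
  (incidence-∉ {w} {h} λ { (inj₁ p) → w≢b (trans p (cong proj₁ eh)) ; (inj₂ p) → w≢v (trans p (cong proj₂ eh)) }))
  (sym (incidence-∈ {w} {x} (inj₁ (sym (cong proj₁ ex)))))
... | no w≢u | yes refl = trans (cong₂ _+_
  (incidence-∉ {w} {g} λ { (inj₁ p) → w≢a (trans p (cong proj₁ eg)) ; (inj₂ p) → w≢u (trans p (cong proj₂ eg)) })
  (incidence-∈ {w} {h} (inj₂ (sym (cong proj₂ eh)))))
  (sym (incidence-∈ {w} {x} (inj₂ (sym (cong proj₂ ex)))))
... | no w≢u | no w≢v = trans (cong₂ _+_
  (incidence-∉ {w} {g} λ { (inj₁ p) → w≢a (trans p (cong proj₁ eg)) ; (inj₂ p) → w≢u (trans p (cong proj₂ eg)) })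
  (incidence-∉ {w} {h} λ { (inj₁ p) → w≢b (trans p (cong proj₁ eh)) ; (inj₂ p) → w≢v (trans p (cong proj₂ eh)) }))
  (sym (incidence-∉ {w} {x} λ { (inj₁ p) → w≢u (trans p (cong proj₁ ex)) ; (inj₂ p) → w≢v (trans p (cong proj₂ ex)) }))

sidesH sidesV : Point → Side → Edge
sidesH (i , j) far   = (i , j) , V
sidesH (i , j) near₁ = (i , j) , H
sidesH (i , j) near₂ = (i , suc j) , H
sidesV (i , j) far   = (i , j) , H
sidesV (i , j) near₁ = (i , j) , V
sidesV (i , j) near₂ = (suc i , j) , V

-- Both new vertices have abscissa i, so the strict bounds keep them off the old graph. `gluingV` is
-- the same with ordinates.
gluingH : ∀ i j {vs es} → (∀ {w} → w ∈ vs → i < proj₁ w) → (∀ {e} → e ∈ es → i < proj₁ (proj₁ e)) →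
  Gluing (i , j) (i , suc j) (sidesH (i , j)) ((suc i , j) , V) vs es
gluingH i j {vs} {es} right-v right-e = record
  { incidence₁ = λ { far → incidence-∈ {i , j} {(i , j) , V} (inj₁ refl)
                   ; near₁ → incidence-∈ {i , j} {(i , j) , H} (inj₁ refl)
                   ; near₂ → incidence-∉ {i , j} {(i , suc j) , H} λ { (inj₁ ()) ; (inj₂ ()) } }
  ; incidence₂ = λ { far → incidence-∈ {i , suc j} {(i , j) , V} (inj₂ refl)
                   ; near₁ → incidence-∉ {i , suc j} {(i , j) , H} λ { (inj₁ ()) ; (inj₂ ()) }
                   ; near₂ → incidence-∈ {i , suc j} {(i , suc j) , H} (inj₁ refl) }
  ; avoid₁ = avoid
  ; avoid₂ = avoid
  ; far-old = λ {w} w∈ → incidence-∉ {w} {(i , j) , V} λ { (inj₁ p) → old w∈ p ; (inj₂ p) → old w∈ p }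
  ; near-old = λ w∈ → incidence-parallel _ _ _ refl refl refl (λ ()) (old w∈) (old w∈)
  }
  where
  old : ∀ {w k} → w ∈ vs → w ≢ (i , k)
  old w∈ refl = <-irrefl refl (right-v w∈)
  avoid : ∀ {k e} → e ∈ es → ¬ (i , k) ∈ₑ e
  avoid {e = _ , H} e∈ (inj₁ refl) = <-irrefl refl (right-e e∈)
  avoid {e = _ , H} e∈ (inj₂ refl) = <-asym (right-e e∈) ≤-refl
  avoid {e = _ , V} e∈ (inj₁ refl) = <-irrefl refl (right-e e∈)
  avoid {e = _ , V} e∈ (inj₂ refl) = <-irrefl refl (right-e e∈)

gluingV : ∀ i j {vs es} → (∀ {w} → w ∈ vs → j < proj₂ w) → (∀ {e} → e ∈ es → j < proj₂ (proj₁ e)) →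
  Gluing (i , j) (suc i , j) (sidesV (i , j)) ((i , suc j) , H) vs es
gluingV i j {vs} {es} above-v above-e = record
  { incidence₁ = λ { far → incidence-∈ {i , j} {(i , j) , H} (inj₁ refl)
                   ; near₁ → incidence-∈ {i , j} {(i , j) , V} (inj₁ refl)
                   ; near₂ → incidence-∉ {i , j} {(suc i , j) , V} λ { (inj₁ ()) ; (inj₂ ()) } }
  ; incidence₂ = λ { far → incidence-∈ {suc i , j} {(i , j) , H} (inj₂ refl)
                   ; near₁ → incidence-∉ {suc i , j} {(i , j) , V} λ { (inj₁ ()) ; (inj₂ ()) }
                   ; near₂ → incidence-∈ {suc i , j} {(suc i , j) , V} (inj₁ refl) }
  ; avoid₁ = avoid
  ; avoid₂ = avoid
  ; far-old = λ {w} w∈ → incidence-∉ {w} {(i , j) , H} λ { (inj₁ p) → old w∈ p ; (inj₂ p) → old w∈ p }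
  ; near-old = λ w∈ → incidence-parallel _ _ _ refl refl refl (λ ()) (old w∈) (old w∈)
  }
  where
  old : ∀ {w k} → w ∈ vs → w ≢ (k , j)
  old w∈ refl = <-irrefl refl (above-v w∈)
  avoid : ∀ {k e} → e ∈ es → ¬ (k , j) ∈ₑ e
  avoid {e = _ , H} e∈ (inj₁ refl) = <-irrefl refl (above-e e∈)
  avoid {e = _ , H} e∈ (inj₂ refl) = <-irrefl refl (above-e e∈)
  avoid {e = _ , V} e∈ (inj₁ refl) = <-irrefl refl (above-e e∈)
  avoid {e = _ , V} e∈ (inj₂ refl) = <-asym (above-e e∈) ≤-refl

-- The perfect matchings are counted according to whether they cover the south-west
-- vertex of the first tile (i , j) by its left or by its bottom edge.
record Counts (t : Point) (vs : List Point) (E : List Edge) (c : ℕ × ℕ) : Set where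
  field
    left   : completions ((t , V) ∷ []) vs (edgeSet E) ≡ proj₁ c
    bottom : completions ((t , H) ∷ []) vs (edgeSet E) ≡ proj₂ c
    total  : completions [] vs (edgeSet E) ≡ proj₁ c + proj₂ c

module _ {i j : ℕ} {vs : List Point} {E : List Edge} {a b : ℕ} where

  -- Forcing the left edge, which is `far`, leaves the whole old graph; forcing the bottom edge
  -- forces the top edge too, and the pair stands for the shared edge. In `attachV` the left and
  -- bottom edges swap these roles.
  attachH : (∀ {w} → w ∈ vs → i < proj₁ w) → (∀ {e} → e ∈ E → i < proj₁ (proj₁ e)) →
    (suc i , j) ∈ vs → (suc i , suc j) ∈ vs → ((suc i , j) , V) ∈ E →
    completions [] vs (edgeSet E) ≡ a → completions (((suc i , j) , V) ∷ []) vs (edgeSet E) ≡ b →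
    Counts (i , j) (tileVertices (i , j) ++ vs) (tileEdges (i , j) ++ E) (a , b)
  attachH right-v right-e u∈ v∈ x∈ eqa eqb = record
    { left   = trans (same (((i , j) , V) ∷ [])) (trans completions-far eqa)
    ; bottom = trans (same (((i , j) , H) ∷ [])) (trans completions-near eqb)
    ; total  = trans (same []) (trans completions-[] (trans (cong₂ _+_ eqb eqa) (+-comm b a)))
    }
    where
    open Gluing (gluingH i j right-v (right-e ∘ ∈-edgeSet⁻))
    v⊆ : tileVertices (i , j) ++ vs ⊆ newVertices
    v⊆ (here p) = here p
    v⊆ (there (here refl)) = there (there u∈)
    v⊆ (there (there (here p))) = there (here p)
    v⊆ (there (there (there (here refl)))) = there (there v∈)
    v⊆ (there (there (there (there p)))) = there (there p)
    v⊇ : newVertices ⊆ tileVertices (i , j) ++ vs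
    v⊇ (here p) = here p
    v⊇ (there (here p)) = there (there (here p))
    v⊇ (there (there p)) = there (there (there (there p)))
    e⊆ : tileEdges (i , j) ++ E ⊆ newEdges
    e⊆ (here p) = there (here p)
    e⊆ (there (here p)) = there (there (here p))
    e⊆ (there (there (here p))) = here p
    e⊆ (there (there (there (here refl)))) = there (there (there (∈-edgeSet⁺ x∈)))
    e⊆ (there (there (there (there p)))) = there (there (there (∈-edgeSet⁺ p)))
    e⊇ : newEdges ⊆ tileEdges (i , j) ++ E
    e⊇ (here p) = there (there (here p))
    e⊇ (there (here p)) = here p
    e⊇ (there (there (here p))) = there (here p)
    e⊇ (there (there (there p))) = there (there (there (there (∈-edgeSet⁻ p))))
    same : ∀ S → completions S (tileVertices (i , j) ++ vs) (edgeSet (tileEdges (i , j) ++ E)) ≡ completions S newVertices newEdges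
    same S = completions-cong S v⊆ v⊇
      (unique-sameElements⇒↭ (edgeSet-unique (tileEdges (i , j) ++ E)) (newEdges-unique (edgeSet-unique E))
        (e⊆ ∘ ∈-edgeSet⁻) (∈-edgeSet⁺ ∘ e⊇))

  attachV : (∀ {w} → w ∈ vs → j < proj₂ w) → (∀ {e} → e ∈ E → j < proj₂ (proj₁ e)) →
    (i , suc j) ∈ vs → (suc i , suc j) ∈ vs → ((i , suc j) , H) ∈ E →
    completions [] vs (edgeSet E) ≡ a → completions (((i , suc j) , H) ∷ []) vs (edgeSet E) ≡ b →
    Counts (i , j) (tileVertices (i , j) ++ vs) (tileEdges (i , j) ++ E) (b , a)
  attachV above-v above-e u∈ v∈ x∈ eqa eqb = record
    { left   = trans (same (((i , j) , V) ∷ [])) (trans completions-near eqb)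
    ; bottom = trans (same (((i , j) , H) ∷ [])) (trans completions-far eqa)
    ; total  = trans (same []) (trans completions-[] (cong₂ _+_ eqb eqa))
    }
    where
    open Gluing (gluingV i j above-v (above-e ∘ ∈-edgeSet⁻))
    v⊆ : tileVertices (i , j) ++ vs ⊆ newVertices
    v⊆ (here p) = here p
    v⊆ (there (here p)) = there (here p)
    v⊆ (there (there (here refl))) = there (there u∈)
    v⊆ (there (there (there (here refl)))) = there (there v∈)
    v⊆ (there (there (there (there p)))) = there (there p)
    v⊇ : newVertices ⊆ tileVertices (i , j) ++ vs
    v⊇ (here p) = here p
    v⊇ (there (here p)) = there (here p)
    v⊇ (there (there p)) = there (there (there (there p)))
    e⊆ : tileEdges (i , j) ++ E ⊆ newEdges
    e⊆ (here p) = here p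
    e⊆ (there (here refl)) = there (there (there (∈-edgeSet⁺ x∈)))
    e⊆ (there (there (here p))) = there (here p)
    e⊆ (there (there (there (here p)))) = there (there (here p))
    e⊆ (there (there (there (there p)))) = there (there (there (∈-edgeSet⁺ p)))
    e⊇ : newEdges ⊆ tileEdges (i , j) ++ E
    e⊇ (here p) = here p
    e⊇ (there (here p)) = there (there (here p))
    e⊇ (there (there (here p))) = there (there (there (here p)))
    e⊇ (there (there (there p))) = there (there (there (there (∈-edgeSet⁻ p))))
    same : ∀ S → completions S (tileVertices (i , j) ++ vs) (edgeSet (tileEdges (i , j) ++ E)) ≡ completions S newVertices newEdges
    same S = completions-cong S v⊆ v⊇
      (unique-sameElements⇒↭ (edgeSet-unique (tileEdges (i , j) ++ E)) (newEdges-unique (edgeSet-unique E))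
        (e⊆ ∘ ∈-edgeSet⁻) (∈-edgeSet⁺ ∘ e⊇))

-- The snake graph of a word

tilesFrom : Point → Word → List Point
tilesFrom t [] = t ∷ []
tilesFrom (i , j) (H ∷ w) = (i , j) ∷ tilesFrom (suc i , j) w
tilesFrom (i , j) (V ∷ w) = (i , j) ∷ tilesFrom (i , suc j) w

vertices : List Point → List Point
vertices = concatMap tileVertices

edges : List Point → List Edge
edges = concatMap tileEdges

_≤P_ : Point → Point → Set
(i , j) ≤P (i′ , j′) = i ≤ i′ × j ≤ j′

≤P-vertex : ∀ t {v} → v ∈ tileVertices t → t ≤P v
≤P-vertex (i , j) (here refl) = ≤-refl , ≤-refl
≤P-vertex (i , j) (there (here refl)) = n≤1+n i , ≤-refl
≤P-vertex (i , j) (there (there (here refl))) = ≤-refl , n≤1+n j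
≤P-vertex (i , j) (there (there (there (here refl)))) = n≤1+n i , n≤1+n j

≤P-edge : ∀ t {e} → e ∈ tileEdges t → t ≤P proj₁ e
≤P-edge (i , j) (here refl) = ≤-refl , ≤-refl
≤P-edge (i , j) (there (here refl)) = ≤-refl , n≤1+n j
≤P-edge (i , j) (there (there (here refl))) = ≤-refl , ≤-refl
≤P-edge (i , j) (there (there (there (here refl)))) = n≤1+n i , ≤-refl

-- Tiles are added only to the right or above. Applied from the second tile on, this gives the
-- strict bounds needed to attach the first.
tilesFrom-≤P : ∀ {A : Set} (f : Point → List A) (π : A → Point) → (∀ t {x} → x ∈ f t → t ≤P π x) →
  ∀ w t {x} → x ∈ concatMap f (tilesFrom t w) → t ≤P π x
tilesFrom-≤P f π bound [] t x∈ with ∈-++⁻ (f t) x∈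
... | inj₁ p = bound t p
tilesFrom-≤P f π bound (H ∷ w) (i , j) x∈ with ∈-++⁻ (f (i , j)) x∈
... | inj₁ p = bound (i , j) p
... | inj₂ p with tilesFrom-≤P f π bound w (suc i , j) p
...   | q₁ , q₂ = <⇒≤ q₁ , q₂
tilesFrom-≤P f π bound (V ∷ w) (i , j) x∈ with ∈-++⁻ (f (i , j)) x∈
... | inj₁ p = bound (i , j) p
... | inj₂ p with tilesFrom-≤P f π bound w (i , suc j) p
...   | q₁ , q₂ = q₁ , <⇒≤ q₂

tilesFrom-head : ∀ {A : Set} (f : Point → List A) w t {x} → x ∈ f t → x ∈ concatMap f (tilesFrom t w)
tilesFrom-head f [] t = ∈-++⁺ˡ
tilesFrom-head f (H ∷ w) t = ∈-++⁺ˡ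
tilesFrom-head f (V ∷ w) t = ∈-++⁺ˡ

-- On the pair (left, bottom), the edge opposite the shared side receives the total, and the other
-- one the count of the shared edge.
step : Dir → ℕ × ℕ → ℕ × ℕ
step H (l , d) = l + d , l
step V (l , d) = d , l + d

countPair : Word → ℕ × ℕ
countPair [] = 1 , 1
countPair (z ∷ w) = step z (countPair w)

tilesFrom-counts : ∀ w t → Counts t (vertices (tilesFrom t w)) (edges (tilesFrom t w)) (countPair w)
-- A single tile is obtained by gluing onto the graph that consists of its right edge x alone.
tilesFrom-counts [] (i , j) = record
  { left   = trans (same (((i , j) , V) ∷ [])) left
  ; bottom = trans (same (((i , j) , H) ∷ [])) bottom
  ; total  = trans (same []) total
  }
  where
  u v : Point
  u = suc i , j
  v = suc i , suc j
  x : Edge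
  x = u , V
  inc-u : incidence u x ≡ 1
  inc-u = incidence-∈ {u} {x} (inj₁ refl)
  inc-v : incidence v x ≡ 1
  inc-v = incidence-∈ {v} {x} (inj₂ refl)
  PM? : ∀ S → Decidable (λ M → IsPerfectMatching (u ∷ v ∷ []) (S ++ M))
  PM? S M = isPerfectMatching? (u ∷ v ∷ []) (S ++ M)
  perfect : ∀ {M} → M ≡ x ∷ [] → IsPerfectMatching (u ∷ v ∷ []) M
  perfect refl = inc-u ∷ inc-v ∷ []
  count-yes : {P : Pred (List Edge) 0ℓ} (P? : Decidable P) → P [] → countSublists P? [] ≡ 1
  count-yes P? p rewrite dec-true (P? []) p = refl
  one : completions [] (u ∷ v ∷ []) (x ∷ []) ≡ 1
  one = trans (count-∷ (PM? []) x []) (cong₂ _+_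
    (count-none (PM? []) [] λ { [] _ (() ∷ _) ; (e ∷ M) M⊆ _ → case M⊆ (here refl) of λ () })
    (count-yes (PM? (x ∷ [])) (perfect refl)))
  one′ : completions (x ∷ []) (u ∷ v ∷ []) (x ∷ []) ≡ 1
  one′ = trans (count-∷ (PM? (x ∷ [])) x []) (cong₂ _+_
    (count-yes (PM? (x ∷ [])) (perfect refl))
    (count-none (PM? (x ∷ x ∷ [])) [] λ
      { [] _ (d ∷ _) → case trans (sym d) (trans (degree-∷ u x (x ∷ [])) (cong₂ _+_ inc-u inc-u)) of λ ()
      ; (e ∷ M) M⊆ _ → case M⊆ (here refl) of λ () }))
  glued : Counts (i , j) (tileVertices (i , j) ++ u ∷ v ∷ []) (tileEdges (i , j) ++ x ∷ []) (1 , 1)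
  glued = attachH
    (λ { (here refl) → ≤-refl ; (there (here refl)) → ≤-refl }) (λ { (here refl) → ≤-refl })
    (here refl) (there (here refl)) (here refl) one one′
  open Counts glued
  v⊆ : tileVertices (i , j) ++ [] ⊆ tileVertices (i , j) ++ u ∷ v ∷ []
  v⊆ p with ∈-++⁻ (tileVertices (i , j)) p
  ... | inj₁ q = ∈-++⁺ˡ q
  v⊇ : tileVertices (i , j) ++ u ∷ v ∷ [] ⊆ tileVertices (i , j) ++ []
  v⊇ p with ∈-++⁻ (tileVertices (i , j)) p
  ... | inj₁ q = ∈-++⁺ˡ q
  ... | inj₂ (here refl) = there (here refl)
  ... | inj₂ (there (here refl)) = there (there (there (here refl)))
  e⊆ : tileEdges (i , j) ++ [] ⊆ tileEdges (i , j) ++ x ∷ []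
  e⊆ p with ∈-++⁻ (tileEdges (i , j)) p
  ... | inj₁ q = ∈-++⁺ˡ q
  e⊇ : tileEdges (i , j) ++ x ∷ [] ⊆ tileEdges (i , j) ++ []
  e⊇ p with ∈-++⁻ (tileEdges (i , j)) p
  ... | inj₁ q = ∈-++⁺ˡ q
  ... | inj₂ (here refl) = there (there (there (here refl)))
  same : ∀ S → completions S (vertices ((i , j) ∷ [])) (edgeSet (edges ((i , j) ∷ []))) ≡
    completions S (tileVertices (i , j) ++ u ∷ v ∷ []) (edgeSet (tileEdges (i , j) ++ x ∷ []))
  same S = completions-edgeSet S v⊆ v⊇ e⊆ e⊇
tilesFrom-counts (H ∷ w) (i , j) = attachH
  (proj₁ ∘ tilesFrom-≤P tileVertices (λ v → v) ≤P-vertex w t) (proj₁ ∘ tilesFrom-≤P tileEdges proj₁ ≤P-edge w t)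
  (tilesFrom-head tileVertices w t (here refl)) (tilesFrom-head tileVertices w t (there (there (here refl))))
  (tilesFrom-head tileEdges w t (there (there (here refl)))) total left
  where
  t = suc i , j
  open Counts (tilesFrom-counts w t)
tilesFrom-counts (V ∷ w) (i , j) = attachV
  (proj₂ ∘ tilesFrom-≤P tileVertices (λ v → v) ≤P-vertex w t) (proj₂ ∘ tilesFrom-≤P tileEdges proj₁ ≤P-edge w t)
  (tilesFrom-head tileVertices w t (here refl)) (tilesFrom-head tileVertices w t (there (here refl)))
  (tilesFrom-head tileEdges w t (here refl)) total bottom
  where
  t = i , suc j
  open Counts (tilesFrom-counts w t)

-- Tiles have side 1/2, so a unit step of the path corresponds to two steps between tiles.
doubled : Word → Word
doubled [] = []
doubled (z ∷ w) = z ∷ z ∷ doubled w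

countPair-doubled : ∀ w → countPair (doubled w) ≡ val w
countPair-doubled [] = refl
countPair-doubled (H ∷ w) rewrite countPair-doubled w = refl
countPair-doubled (V ∷ w) rewrite countPair-doubled w =
  cong (proj₁ (val w) + proj₂ (val w) ,_) (+-comm (proj₂ (val w)) (proj₁ (val w) + proj₂ (val w)))

-- The tiles of the snake graph

-- This and the next definitions up to `keepTile` are named copies of the local ones behind
-- `snakeTiles`, to which they are equal by computation.
range : ℕ → ℕ → List ℕ
range a b = map (a +_) (upTo (suc (b ∸ a)))

range≡ : ∀ {a b} d → b ≡ a + d → range a b ≡ map (a +_) (upTo (suc d))
range≡ {a} d refl = cong (λ n → map (a +_) (upTo (suc n))) (m+n∸m≡n a d)

rightColumn : (r s : ℕ) → .{{NonZero s}} → ℕ → List Point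
rightColumn r s k = map (suc (2 * k) ,_) (range (2 * pathHeight r s k) ((2 * pathHeight r s (suc k)) ⊓ (2 * r ∸ 1)))

column : (r s : ℕ) → .{{NonZero s}} → ℕ → List Point
column r s k = (2 * k , 2 * pathHeight r s k) ∷ rightColumn r s k

keepTile : (r s : ℕ) → Point → Bool
keepTile r s (a , b) =
  if ((a ≡ᵇ 0) ∧ (b ≡ᵇ 0)) ∨ ((a ≡ᵇ 2 * s ∸ 1) ∧ (b ≡ᵇ 2 * r ∸ 1)) then false else true

pathHeight≡ : ∀ r s .{{_ : NonZero s}} {k c h} → r * k ≡ c + h * s → c < s → pathHeight r s k ≡ h
pathHeight≡ r s {k} {c} {h} eq c<s = begin
  (r * k) / s            ≡⟨ cong (_/ s) eq ⟩
  (c + h * s) / s        ≡⟨ +-distrib-/-∣ʳ c (n∣m*n h) ⟩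
  c / s + (h * s) / s    ≡⟨ cong₂ _+_ (m<n⇒m/n≡0 c<s) (m*n/n≡m h s) ⟩
  h                      ∎
  where open ≡-Reasoning

keep-inside : ∀ r s x y ts → y < 2 * r ∸ 1 →
  filterᵇ (keepTile r s) ((suc x , y) ∷ ts) ≡ (suc x , y) ∷ filterᵇ (keepTile r s) ts
keep-inside r s x y ts y< = filter-accept (T? ∘ keepTile r s) (subst T (sym kept) tt)
  where
  kept : keepTile r s (suc x , y) ≡ true
  kept rewrite dec-false (y ≟ 2 * r ∸ 1) (<⇒≢ y<) | ∧-zeroʳ (suc x ≡ᵇ 2 * s ∸ 1) = refl

drop-last : ∀ r s → filterᵇ (keepTile (suc r) (suc s)) ((suc (2 * s) , suc (2 * r)) ∷ []) ≡ []
drop-last r s = filter-reject (T? ∘ keepTile (suc r) (suc s)) {suc (2 * s) , suc (2 * r)} {[]} (subst T dropped)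
  where
  dropped : keepTile (suc r) (suc s) (suc (2 * s) , suc (2 * r)) ≡ false
  dropped rewrite dec-true (suc (2 * s) ≟ 2 * suc s ∸ 1) (sym (+-suc s (s + 0)))
                | dec-true (suc (2 * r) ≟ 2 * suc r ∸ 1) (sym (+-suc r (r + 0))) = refl

2*<2*∸1 : ∀ {h r} → h < r → 2 * h < 2 * r ∸ 1
2*<2*∸1 {h} {suc r} (s≤s h≤r) = subst (2 * h <_) (sym (+-suc r (r + 0))) (s≤s (*-monoʳ-≤ 2 h≤r))

module _ {r s : ℕ} (r≤s : r ≤ suc s) (0<r : 0 < r) where

  private S = suc s

  columnsFrom : (ℕ → ℕ) → ℕ → List Point
  columnsFrom f n = concat (map (column r S) (applyUpTo f n))

  rightColumn≡ : ∀ {k h h′} d → pathHeight r S k ≡ h → pathHeight r S (suc k) ≡ h′ → (2 * h′) ⊓ (2 * r ∸ 1) ≡ 2 * h + d →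
    rightColumn r S k ≡ map (suc (2 * k) ,_) (map (2 * h +_) (upTo (suc d)))
  rightColumn≡ {k} d refl refl eq = cong (map (suc (2 * k) ,_)) (range≡ d eq)

  -- As r s = r S - r with 0 < r ≤ S, the path runs through the last column exactly one unit below
  -- the top.
  last-height : ∀ {c h} → r * s ≡ c + h * S → c < S → suc h ≡ r
  last-height {c} {h} eq c<S = ≤-antisym
    (*-cancelʳ-< S h r (begin-strict
      h * S            ≤⟨ m≤n+m (h * S) c ⟩
      c + h * S        <⟨ m<n+m (c + h * S) 0<r ⟩
      r + (c + h * S)  ≡⟨ total ⟩
      r * S            ∎))
    (≤-pred (*-cancelʳ-< S r (2 + h) (begin-strict
      r * S            ≡⟨ total ⟨
      r + (c + h * S)  <⟨ +-mono-≤-< r≤s (+-monoˡ-< (h * S) c<S) ⟩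
      (2 + h) * S      ∎)))
    where
    open ≤-Reasoning
    total : r + (c + h * S) ≡ r * S
    total = trans (cong (r +_) (sym eq)) (sym (*-suc r s))

  inner-height : ∀ {k c h} → r * k ≡ c + h * S → k < S → h < r
  inner-height {k} {c} {h} eq k<S = *-cancelʳ-< S h r (begin-strict
    h * S      ≤⟨ m≤n+m (h * S) c ⟩
    c + h * S  ≡⟨ eq ⟨
    r * k      <⟨ *-monoʳ-< r {{>-nonZero 0<r}} k<S ⟩
    r * S      ∎)
    where open ≤-Reasoning

  -- The induction cuts before right half-columns: one of them and the left tile of the next column
  -- are the tiles of one block `V ∷ H` or `H` of the greedy word. The numbering f of the columns
  -- varies as `upTo` unfolds.
  tiles-greedy : ∀ n k c h (f : ℕ → ℕ) → (∀ i → f i ≡ i + suc k) → n + suc k ≡ S → r * k ≡ c + h * S → c < S →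
    filterᵇ (keepTile r S) (rightColumn r S k ++ columnsFrom f n) ≡ tilesFrom (suc (2 * k) , 2 * h) (doubled (greedy r S n c))
  -- In the last column the cut at 2 r - 1 leaves two tiles; the upper one is the final tile, which
  -- is dropped.
  tiles-greedy zero k c h f f≡ refl rk≡ c<S with last-height {c} {h} rk≡ c<S
  ... | refl = begin
    filterᵇ K (rightColumn r S s ++ [])
      ≡⟨ cong (λ ts → filterᵇ K (ts ++ []))
           (rightColumn≡ {s} {h} 1 (pathHeight≡ r S {s} {c} rk≡ c<S) (pathHeight≡ r S {S} {0} {r} refl z<s) eq) ⟩
    filterᵇ K ((a , 2 * h + 0) ∷ (a , 2 * h + 1) ∷ [])
      ≡⟨ cong₂ (λ y z → filterᵇ K ((a , y) ∷ (a , z) ∷ [])) (+-identityʳ (2 * h)) (+-comm (2 * h) 1) ⟩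
    filterᵇ K ((a , 2 * h) ∷ (a , suc (2 * h)) ∷ [])
      ≡⟨ keep-inside r S (2 * s) (2 * h) _ (2*<2*∸1 {h} {r} ≤-refl) ⟩
    (a , 2 * h) ∷ filterᵇ K ((a , suc (2 * h)) ∷ [])
      ≡⟨ cong ((a , 2 * h) ∷_) (drop-last h s) ⟩
    (a , 2 * h) ∷ [] ∎
    where
    open ≡-Reasoning
    K = keepTile r S
    a = suc (2 * s)
    eq : (2 * r) ⊓ (2 * r ∸ 1) ≡ 2 * h + 1
    eq = trans (m≥n⇒m⊓n≡n (m∸n≤m (2 * r) 1)) (trans (+-suc h (h + 0)) (+-comm 1 (2 * h)))
  tiles-greedy (suc n) k c h f f≡ n+k≡ rk≡ c<S with S ≤? c + r
  ... | yes S≤c+r = begin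
    filterᵇ K (rightColumn r S k ++ column r S (f 0) ++ columnsFrom (f ∘ suc) n)
      ≡⟨ cong₂ (λ ts i → filterᵇ K (ts ++ column r S i ++ columnsFrom (f ∘ suc) n))
           (rightColumn≡ {k} {h} 2 (pathHeight≡ r S {k} {c} rk≡ c<S) height′ eq) (f≡ 0) ⟩
    filterᵇ K ((a , 2 * h + 0) ∷ (a , 2 * h + 1) ∷ (a , 2 * h + 2) ∷ (2 * suc k , 2 * pathHeight r S (suc k)) ∷ rest)
      ≡⟨ cong (filterᵇ K) (cong₂ (λ y ts → (a , y) ∷ ts) (+-identityʳ (2 * h))
           (cong₂ (λ y ts → (a , y) ∷ ts) (+-comm (2 * h) 1)
           (cong₂ (λ y ts → (a , y) ∷ ts) (+-comm (2 * h) 2)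
           (cong₂ (λ x y → (x , y) ∷ rest) (*-suc 2 k) (trans (cong (2 *_) height′) (*-suc 2 h)))))) ⟩
    filterᵇ K ((a , 2 * h) ∷ (a , 1 + 2 * h) ∷ (a , 2 + 2 * h) ∷ (suc a , 2 + 2 * h) ∷ rest)
      ≡⟨ trans (keep-inside r S _ _ _ (<⇒≤ (<⇒≤ low))) (cong (_ ∷_) (trans (keep-inside r S _ _ _ (<⇒≤ low)) (cong (_ ∷_)
           (trans (keep-inside r S _ _ _ low) (cong (_ ∷_) (keep-inside r S a _ rest low)))))) ⟩
    (a , 2 * h) ∷ (a , 1 + 2 * h) ∷ (a , 2 + 2 * h) ∷ (suc a , 2 + 2 * h) ∷ filterᵇ K rest
      ≡⟨ cong (λ ts → (a , 2 * h) ∷ (a , 1 + 2 * h) ∷ (a , 2 + 2 * h) ∷ (suc a , 2 + 2 * h) ∷ ts)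
           (trans (tiles-greedy n (suc k) c′ (suc h) (f ∘ suc) f≡′ n+k≡′ rk≡′ c′<S)
                  (cong₂ (λ x y → tilesFrom (x , y) (doubled (greedy r S n c′))) (cong suc (*-suc 2 k)) (*-suc 2 h))) ⟩
    tilesFrom (a , 2 * h) (doubled (V ∷ H ∷ greedy r S n c′)) ∎
    where
    open ≡-Reasoning
    K = keepTile r S
    a = suc (2 * k)
    c′ = c + r ∸ S
    rest = rightColumn r S (suc k) ++ columnsFrom (f ∘ suc) n
    f≡′ : ∀ i → f (suc i) ≡ i + suc (suc k)
    f≡′ i = trans (f≡ (suc i)) (sym (+-suc i (suc k)))
    n+k≡′ : n + suc (suc k) ≡ S
    n+k≡′ = trans (+-suc n (suc k)) n+k≡
    rk≡′ : r * suc k ≡ c′ + suc h * S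
    rk≡′ = trans (*-suc r k) (trans (cong (r +_) rk≡) (trans (left r c (h * S))
      (trans (cong (_+ h * S) (sym (m∸n+n≡m S≤c+r))) (+-assoc c′ S (h * S)))))
      where
      left : ∀ r c x → r + (c + x) ≡ c + r + x
      left = solve-∀
    c′<S : c′ < S
    c′<S = +-cancelʳ-< S c′ S (subst (_< S + S) (sym (m∸n+n≡m S≤c+r)) (+-mono-<-≤ c<S r≤s))
    height′ : pathHeight r S (suc k) ≡ suc h
    height′ = pathHeight≡ r S rk≡′ c′<S
    low₀ : 2 * suc h < 2 * r ∸ 1
    low₀ = 2*<2*∸1 {suc h} (inner-height {suc k} {c′} rk≡′ (subst (suc k <_) n+k≡ (s≤s (m≤n+m (suc k) n))))
    low : 2 + 2 * h < 2 * r ∸ 1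
    low = subst (_< 2 * r ∸ 1) (*-suc 2 h) low₀
    eq : (2 * suc h) ⊓ (2 * r ∸ 1) ≡ 2 * h + 2
    eq = trans (m≤n⇒m⊓n≡m (<⇒≤ low₀)) (trans (*-suc 2 h) (+-comm 2 (2 * h)))
  ... | no S≰c+r = begin
    filterᵇ K (rightColumn r S k ++ column r S (f 0) ++ columnsFrom (f ∘ suc) n)
      ≡⟨ cong₂ (λ ts i → filterᵇ K (ts ++ column r S i ++ columnsFrom (f ∘ suc) n))
           (rightColumn≡ {k} {h} 0 (pathHeight≡ r S {k} {c} rk≡ c<S) height′ eq) (f≡ 0) ⟩
    filterᵇ K ((a , 2 * h + 0) ∷ (2 * suc k , 2 * pathHeight r S (suc k)) ∷ rest)
      ≡⟨ cong (filterᵇ K) (cong₂ (λ y ts → (a , y) ∷ ts) (+-identityʳ (2 * h))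
           (cong₂ (λ x y → (x , y) ∷ rest) (*-suc 2 k) (cong (2 *_) height′))) ⟩
    filterᵇ K ((a , 2 * h) ∷ (suc a , 2 * h) ∷ rest)
      ≡⟨ trans (keep-inside r S _ _ _ low) (cong (_ ∷_) (keep-inside r S a _ rest low)) ⟩
    (a , 2 * h) ∷ (suc a , 2 * h) ∷ filterᵇ K rest
      ≡⟨ cong (λ ts → (a , 2 * h) ∷ (suc a , 2 * h) ∷ ts)
           (trans (tiles-greedy n (suc k) (c + r) h (f ∘ suc) f≡′ n+k≡′ rk≡′ c′<S)
                  (cong (λ x → tilesFrom (x , 2 * h) (doubled (greedy r S n (c + r)))) (cong suc (*-suc 2 k)))) ⟩
    tilesFrom (a , 2 * h) (doubled (H ∷ greedy r S n (c + r))) ∎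
    where
    open ≡-Reasoning
    K = keepTile r S
    a = suc (2 * k)
    rest = rightColumn r S (suc k) ++ columnsFrom (f ∘ suc) n
    f≡′ : ∀ i → f (suc i) ≡ i + suc (suc k)
    f≡′ i = trans (f≡ (suc i)) (sym (+-suc i (suc k)))
    n+k≡′ : n + suc (suc k) ≡ S
    n+k≡′ = trans (+-suc n (suc k)) n+k≡
    rk≡′ : r * suc k ≡ c + r + h * S
    rk≡′ = trans (*-suc r k) (trans (cong (r +_) rk≡) (left r c (h * S)))
      where
      left : ∀ r c x → r + (c + x) ≡ c + r + x
      left = solve-∀
    c′<S : c + r < S
    c′<S = ≰⇒> S≰c+r
    height′ : pathHeight r S (suc k) ≡ h
    height′ = pathHeight≡ r S rk≡′ c′<S
    low : 2 * h < 2 * r ∸ 1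
    low = 2*<2*∸1 {h} (inner-height {suc k} {c + r} rk≡′ (subst (suc k <_) n+k≡ (s≤s (m≤n+m (suc k) n))))
    eq : (2 * h) ⊓ (2 * r ∸ 1) ≡ 2 * h + 0
    eq = trans (m≤n⇒m⊓n≡m (<⇒≤ low)) (sym (+-identityʳ (2 * h)))

  snakeTiles≡ : snakeTiles r S ≡ tilesFrom (1 , 0) (doubled (christoffel r S))
  snakeTiles≡ = begin
    filterᵇ K ((0 , 2 * pathHeight r S 0) ∷ rest)
      ≡⟨ cong (λ h → filterᵇ K ((0 , 2 * h) ∷ rest)) (pathHeight≡ r S {0} {0} {0} (*-zeroʳ r) z<s) ⟩
    filterᵇ K rest
      ≡⟨ tiles-greedy s 0 0 0 suc (λ i → +-comm 1 i) (+-comm s 1) (*-zeroʳ r) z<s ⟩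
    tilesFrom (1 , 0) (doubled (christoffel r S)) ∎
    where
    open ≡-Reasoning
    K = keepTile r S
    rest = rightColumn r S 0 ++ columnsFrom suc s

  m≡weight : m r S ≡ weight (christoffel r S)
  m≡weight = begin
    completions [] (deduplicate _≟P_ (vertices (snakeTiles r S))) (edgeSet (edges (snakeTiles r S)))
      ≡⟨ completions-cong [] {es = edgeSet (edges (snakeTiles r S))}
           (∈-deduplicate⁻ _≟P_ (vertices (snakeTiles r S))) (∈-deduplicate⁺ _≟P_) ↭-refl ⟩
    completions [] (vertices (snakeTiles r S)) (edgeSet (edges (snakeTiles r S)))
      ≡⟨ cong (λ ts → completions [] (vertices ts) (edgeSet (edges ts))) snakeTiles≡ ⟩
    completions [] (vertices (tilesFrom (1 , 0) (doubled w))) (edgeSet (edges (tilesFrom (1 , 0) (doubled w))))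
      ≡⟨ Counts.total (tilesFrom-counts (doubled w) (1 , 0)) ⟩
    proj₁ (countPair (doubled w)) + proj₂ (countPair (doubled w))
      ≡⟨ cong (λ v → proj₁ v + proj₂ v) (countPair-doubled w) ⟩
    proj₁ (val w) + proj₂ (val w)
      ≡⟨ cong₂ _+_ (*-identityˡ (proj₁ (val w))) (*-identityˡ (proj₂ (val w))) ⟨
    weight w ∎
    where
    open ≡-Reasoning
    w = christoffel r S

theorem4p6 : (p q : ℕ) → 0 < p → p < q →
    (m p q < m p (suc q)) × (m p q < m (suc p) q)
theorem4p6 p (suc q) 0<p p<q =
    subst₂ _<_ (sym (m≡weight (<⇒≤ p<q) 0<p)) (sym (m≡weight (≤-trans (<⇒≤ p<q) (n≤1+n _)) 0<p))
      (christoffel-<-denominator 0<p p<q)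
  , subst₂ _<_ (sym (m≡weight (<⇒≤ p<q) 0<p)) (sym (m≡weight p<q z<s)) (christoffel-<-numerator 0<p p<q)
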